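{- Let $\ell\ge 5$ be a prime number, $N>0$ an integer prime to $\ell$, and $k>2$ an integer. Let $f\in S_{k}(\Gamma_{0}(N))$ be a normalized eigenform and let $\lambda$ be a prime of $K_f$ lying over $\ell$. Suppose the representation $\rho_{f,\ell}=\rho_{f,\lambda}$ is irreducible. Let $i$ be an integer with $0\le i \le \ell-1$ such that, with $$H=\{x \bmod N\ell \ :\ 0<x<N\ell,\ \gcd(x,N\ell)=1,\ \varepsilon(x)\,x^{k-2-2i} \equiv 1 \bmod \lambda \}\subseteq (\mathbb{Z}/N\ell\mathbb{Z})^{*},\qquad \Gamma_H=\Gamma_H(N\ell)$$ (where $\varepsilon$ is the nebentypus character of $f$, here trivial), there exist a normalized eigenform $f_2\in S_2(\Gamma_H)$ and a prime $\lambda_2$ of $K_{f_2}$ over $\ell$ with $\rho_{f,\lambda}\cong\rho_{f_2,\lambda_2}\otimes\chi_\ell^i$. Then $\Gamma_H=\Gamma_{0}(N\ell)$ if and only if $\ell-1$ divides $k-2-2i$.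
   Context: For a positive integer $n$ and a subgroup $H$ of $(\mathbb{Z}/n\mathbb{Z})^{*}$, $\Gamma_H(n)$ is the group of matrices $\begin{pmatrix} a&b\\c&d\end{pmatrix}\in SL(2,\mathbb{Z})$ with $c\equiv 0 \pmod n$ and $d \bmod n\in H$; $\Gamma_0(n)$ and $\Gamma_1(n)$ are the cases $H=(\mathbb{Z}/n\mathbb{Z})^*$ and $H=\{1\}$. $S_k(\Gamma)$ is the space of cusp forms of weight $k$ on $\Gamma$. A normalized eigenform $g=\sum_{m>0}a_m(g)q^m$ is a Hecke eigenform with $a_1(g)=1$; $K_g$ is the number field generated by all the coefficients $a_m(g)$. For a normalized eigenform $g\in S_k(\Gamma_1(n))$ with nebentypus $\varepsilon$ and a prime $\mu$ of $K_g$ over $\ell$, with residue field embedded in $\overline{\mathbb{F}}_\ell$, $\rho_{g,\mu}:\mathrm{Gal}(\overline{\mathbb{Q}}/\mathbb{Q})\to GL_2(\overline{\mathbb{F}}_\ell)$ is the unique (up to isomorphism) continuous semisimple representation, unramified outside $n\ell$, such that for all primes $p\nmid n\ell$ the characteristic polynomial of $\rho_{g,\mu}(\mathrm{Frob}_p)$ is $x^2-a_p(g)x+\varepsilon(p)p^{k-1} \bmod \mu$; isomorphisms between representations attached to different forms are understood for suitable embeddings of residue fields. $\chi_\ell$ is the mod $\ell$ cyclotomic character. Negative powers of $x$ are taken modulo $\ell$. -}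

module Defs where

open import Algebra.Bundles using (CommutativeRing; Semiring)
open import Algebra.Morphism.Structures using (module RingMorphisms)
import Algebra.Morphism.Construct.Identity as Identity
import Algebra.Morphism.Construct.Composition as Composition
import Algebra.Definitions.RawSemiring as RawSemiringDefs
open import Algebra.Structures using (IsCommutativeRing)
open import Data.Fin.Base using (Fin; toℕ)
open import Data.Integer.Base as ℤ using (ℤ; +_; -[1+_])
import Data.Integer.Divisibility.Signed as ℤ
open import Data.List.Base using (List)
open import Data.List.Relation.Unary.All using (All)
open import Data.Nat.Base as ℕ using (ℕ; zero; suc; _!)
import Data.Nat.Properties as ℕ
import Data.Nat.Divisibility as ℕ
open import Data.Nat.Coprimality using (Coprime)
open import Data.Nat.Primality using (Prime)
open import Data.Product.Base using (∃-syntax; Σ-syntax; _×_; _,_; proj₁; proj₂)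
open import Data.Rational.Base as ℚ using (ℚ; 0ℚ; 1ℚ; ½)
import Data.Rational.Properties as ℚ
open import Data.Rational.Solver using (module +-*-Solver)
open import Data.Sum.Base using (_⊎_)
open import Function.Base using (_∘_)
open import Function.Bundles using (_⇔_)
open import Level using (0ℓ)
open import Relation.Binary.PropositionalEquality
  using (_≡_; refl; sym; trans; cong; cong₂; subst)
open import Relation.Binary.Structures using (IsEquivalence)
open import Relation.Nullary using (¬_)

-- Real numbers are Cauchy sequences of rationals.
-- x ∼ y says that |x m - y n| tends to 0 as m and n both tend to infinity.
-- It is a partial equivalence relation, and x ∼ x is the Cauchy condition.
infix 4 _∼_
_∼_ : (x y : ℕ → ℚ) → Set
x ∼ y = ∀ e → 0ℚ ℚ.< e →
  ∃[ N ] ∀ m n → N ℕ.≤ m → N ℕ.≤ n → ℚ.∣ x m ℚ.- y n ∣ ℚ.≤ e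

private
  half-pos : ∀ e → 0ℚ ℚ.< e → 0ℚ ℚ.< e ℚ.* ½
  half-pos e 0<e = ℚ.positive⁻¹ (e ℚ.* ½) {{ℚ.pos*pos⇒pos e {{ℚ.positive 0<e}} ½}}

  half+half : ∀ e → e ℚ.* ½ ℚ.+ e ℚ.* ½ ≡ e
  half+half e = trans (sym (ℚ.*-distribˡ-+ e ½ ½)) (ℚ.*-identityʳ e)

  dist-sym : ∀ p q → ℚ.∣ p ℚ.- q ∣ ≡ ℚ.∣ q ℚ.- p ∣
  dist-sym p q = trans (sym (ℚ.∣-p∣≡∣p∣ (p ℚ.- q)))
    (cong ℚ.∣_∣ (solve 2 (λ a b → :- (a :- b) := b :- a) refl p q))
    where open +-*-Solver

∼-sym : ∀ {x y} → x ∼ y → y ∼ x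
∼-sym {x} {y} x∼y e 0<e with x∼y e 0<e
... | N , h = N , λ m n N≤m N≤n →
  subst (ℚ._≤ e) (dist-sym (x n) (y m)) (h n m N≤n N≤m)

∼-trans : ∀ {x y z} → x ∼ y → y ∼ z → x ∼ z
∼-trans {x} {y} {z} x∼y y∼z e 0<e
  with x∼y (e ℚ.* ½) (half-pos e 0<e) | y∼z (e ℚ.* ½) (half-pos e 0<e)
... | M , h | N , k = M ℕ.⊔ N , λ m n ≤m ≤n →
  let l = M ℕ.⊔ N in begin
  ℚ.∣ x m ℚ.- z n ∣
    ≡⟨ cong ℚ.∣_∣ (solve 3 (λ a b c → a :- c := (a :- b) :+ (b :- c)) refl (x m) (y l) (z n)) ⟩
  ℚ.∣ (x m ℚ.- y l) ℚ.+ (y l ℚ.- z n) ∣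
    ≤⟨ ℚ.∣p+q∣≤∣p∣+∣q∣ (x m ℚ.- y l) (y l ℚ.- z n) ⟩
  ℚ.∣ x m ℚ.- y l ∣ ℚ.+ ℚ.∣ y l ℚ.- z n ∣
    ≤⟨ ℚ.+-mono-≤ (h m l (ℕ.≤-trans (ℕ.m≤m⊔n M N) ≤m) (ℕ.m≤m⊔n M N))
                  (k l n (ℕ.m≤n⊔m M N) (ℕ.≤-trans (ℕ.m≤n⊔m M N) ≤n)) ⟩
  e ℚ.* ½ ℚ.+ e ℚ.* ½
    ≡⟨ half+half e ⟩
  e ∎
  where open ℚ.≤-Reasoning
        open +-*-Solver

∼-pointwise : ∀ {x y} → x ∼ x → (∀ n → x n ≡ y n) → x ∼ y
∼-pointwise {x} x∼x x≗y e 0<e with x∼x e 0<e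
... | N , h = N , λ m n N≤m N≤n →
  subst (λ t → ℚ.∣ x m ℚ.- t ∣ ℚ.≤ e) (x≗y n) (h m n N≤m N≤n)

∼-const : ∀ q → (λ _ → q) ∼ (λ _ → q)
∼-const q e 0<e = 0 , λ _ _ _ _ →
  subst (λ t → ℚ.∣ t ∣ ℚ.≤ e) (sym (ℚ.+-inverseʳ q)) (ℚ.<⇒≤ 0<e)

∼-+ : ∀ {x x′ y y′} → x ∼ x′ → y ∼ y′ →
      (λ n → x n ℚ.+ y n) ∼ (λ n → x′ n ℚ.+ y′ n)
∼-+ {x} {x′} {y} {y′} x∼x′ y∼y′ e 0<e
  with x∼x′ (e ℚ.* ½) (half-pos e 0<e) | y∼y′ (e ℚ.* ½) (half-pos e 0<e)
... | M , h | N , k = M ℕ.⊔ N , λ m n ≤m ≤n → begin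
  ℚ.∣ (x m ℚ.+ y m) ℚ.- (x′ n ℚ.+ y′ n) ∣
    ≡⟨ cong ℚ.∣_∣ (solve 4 (λ a b c d → (a :+ b) :- (c :+ d) := (a :- c) :+ (b :- d))
                     refl (x m) (y m) (x′ n) (y′ n)) ⟩
  ℚ.∣ (x m ℚ.- x′ n) ℚ.+ (y m ℚ.- y′ n) ∣
    ≤⟨ ℚ.∣p+q∣≤∣p∣+∣q∣ (x m ℚ.- x′ n) (y m ℚ.- y′ n) ⟩
  ℚ.∣ x m ℚ.- x′ n ∣ ℚ.+ ℚ.∣ y m ℚ.- y′ n ∣
    ≤⟨ ℚ.+-mono-≤ (h m n (ℕ.≤-trans (ℕ.m≤m⊔n M N) ≤m) (ℕ.≤-trans (ℕ.m≤m⊔n M N) ≤n))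
                  (k m n (ℕ.≤-trans (ℕ.m≤n⊔m M N) ≤m) (ℕ.≤-trans (ℕ.m≤n⊔m M N) ≤n)) ⟩
  e ℚ.* ½ ℚ.+ e ℚ.* ½
    ≡⟨ half+half e ⟩
  e ∎
  where open ℚ.≤-Reasoning
        open +-*-Solver

∼-neg : ∀ {x x′} → x ∼ x′ → (λ n → ℚ.- x n) ∼ (λ n → ℚ.- x′ n)
∼-neg {x} {x′} x∼x′ e 0<e with x∼x′ e 0<e
... | N , h = N , λ m n N≤m N≤n → subst (ℚ._≤ e)
  (trans (sym (ℚ.∣-p∣≡∣p∣ (x m ℚ.- x′ n)))
         (cong ℚ.∣_∣ (solve 2 (λ a b → :- (a :- b) := (:- a) :- (:- b)) refl (x m) (x′ n))))
  (h m n N≤m N≤n)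
  where open +-*-Solver

private
  bounded : ∀ {x} → x ∼ x →
            ∃[ B ] ∃[ N ] 0ℚ ℚ.< B × (∀ n → N ℕ.≤ n → ℚ.∣ x n ∣ ℚ.≤ B)
  bounded {x} x∼x with x∼x 1ℚ (ℚ.positive⁻¹ 1ℚ)
  ... | N , h = 1ℚ ℚ.+ ℚ.∣ x N ∣ , N
    , ℚ.positive⁻¹ (1ℚ ℚ.+ ℚ.∣ x N ∣)
        {{ℚ.pos+nonNeg⇒pos 1ℚ ℚ.∣ x N ∣ {{ℚ.∣-∣-nonNeg (x N)}}}}
    , λ n N≤n → begin
    ℚ.∣ x n ∣
      ≡⟨ cong ℚ.∣_∣ (solve 2 (λ a b → a := (a :- b) :+ b) refl (x n) (x N)) ⟩
    ℚ.∣ (x n ℚ.- x N) ℚ.+ x N ∣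
      ≤⟨ ℚ.∣p+q∣≤∣p∣+∣q∣ (x n ℚ.- x N) (x N) ⟩
    ℚ.∣ x n ℚ.- x N ∣ ℚ.+ ℚ.∣ x N ∣
      ≤⟨ ℚ.+-monoˡ-≤ ℚ.∣ x N ∣ (h n N N≤n ℕ.≤-refl) ⟩
    1ℚ ℚ.+ ℚ.∣ x N ∣ ∎
    where open ℚ.≤-Reasoning
          open +-*-Solver

  *-mono-abs : ∀ p q {B d} → 0ℚ ℚ.≤ B → ℚ.∣ p ∣ ℚ.≤ B → ℚ.∣ q ∣ ℚ.≤ d →
               ℚ.∣ p ℚ.* q ∣ ℚ.≤ B ℚ.* d
  *-mono-abs p q {B} {d} 0≤B p≤B q≤d = begin
    ℚ.∣ p ℚ.* q ∣        ≡⟨ ℚ.∣p*q∣≡∣p∣*∣q∣ p q ⟩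
    ℚ.∣ p ∣ ℚ.* ℚ.∣ q ∣  ≤⟨ ℚ.*-monoʳ-≤-nonNeg ℚ.∣ q ∣ {{ℚ.∣-∣-nonNeg q}} p≤B ⟩
    B ℚ.* ℚ.∣ q ∣        ≤⟨ ℚ.*-monoˡ-≤-nonNeg B {{ℚ.nonNegative 0≤B}} q≤d ⟩
    B ℚ.* d              ∎
    where open ℚ.≤-Reasoning

  product-dist : ∀ a b c d {A B r s} → 0ℚ ℚ.≤ A → 0ℚ ℚ.≤ B →
    ℚ.∣ a ∣ ℚ.≤ A → ℚ.∣ d ∣ ℚ.≤ B → ℚ.∣ b ℚ.- d ∣ ℚ.≤ r → ℚ.∣ a ℚ.- c ∣ ℚ.≤ s →
    ℚ.∣ a ℚ.* b ℚ.- c ℚ.* d ∣ ℚ.≤ A ℚ.* r ℚ.+ B ℚ.* s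
  product-dist a b c d {A} {B} {r} {s} 0≤A 0≤B a≤A d≤B b-d a-c = begin
    ℚ.∣ a ℚ.* b ℚ.- c ℚ.* d ∣
      ≡⟨ cong ℚ.∣_∣ (solve 4 (λ a b c d → a :* b :- c :* d := a :* (b :- d) :+ d :* (a :- c))
                       refl a b c d) ⟩
    ℚ.∣ a ℚ.* (b ℚ.- d) ℚ.+ d ℚ.* (a ℚ.- c) ∣
      ≤⟨ ℚ.∣p+q∣≤∣p∣+∣q∣ (a ℚ.* (b ℚ.- d)) (d ℚ.* (a ℚ.- c)) ⟩
    ℚ.∣ a ℚ.* (b ℚ.- d) ∣ ℚ.+ ℚ.∣ d ℚ.* (a ℚ.- c) ∣
      ≤⟨ ℚ.+-mono-≤ (*-mono-abs a (b ℚ.- d) 0≤A a≤A b-d) (*-mono-abs d (a ℚ.- c) 0≤B d≤B a-c) ⟩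
    A ℚ.* r ℚ.+ B ℚ.* s ∎
    where open ℚ.≤-Reasoning
          open +-*-Solver

  divide-pos : ∀ e D → 0ℚ ℚ.< e → 0ℚ ℚ.< D → ∃[ d ] 0ℚ ℚ.< d × D ℚ.* d ≡ e
  divide-pos e D 0<e 0<D = e ℚ.* i , 0<ei ,
    trans (solve 3 (λ D e i → D :* (e :* i) := e :* (D :* i)) refl D e i)
          (trans (cong (e ℚ.*_) Di≡1) (ℚ.*-identityʳ e))
    where
    open +-*-Solver
    i : ℚ
    i = (ℚ.1/ D) {{ℚ.pos⇒nonZero D {{ℚ.positive 0<D}}}}
    Di≡1 : D ℚ.* i ≡ 1ℚ
    Di≡1 = ℚ.*-inverseʳ D {{ℚ.pos⇒nonZero D {{ℚ.positive 0<D}}}}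
    0<ei : 0ℚ ℚ.< e ℚ.* i
    0<ei = ℚ.positive⁻¹ (e ℚ.* i)
      {{ℚ.pos*pos⇒pos e {{ℚ.positive 0<e}} i {{ℚ.1/pos⇒pos D {{ℚ.positive 0<D}}}}}}

∼-* : ∀ {x x′ y y′} → x ∼ x′ → y ∼ y′ →
      (λ n → x n ℚ.* y n) ∼ (λ n → x′ n ℚ.* y′ n)
∼-* {x} {x′} {y} {y′} x∼x′ y∼y′ e 0<e =
  let
    A , K , 0<A , x≤A  = bounded {x} (∼-trans {x} {x′} {x} x∼x′ (∼-sym {x} {x′} x∼x′))
    B , L , 0<B , y′≤B = bounded {y′} (∼-trans {y′} {y} {y′} (∼-sym {y} {y′} y∼y′) y∼y′)
    r , 0<r , Ar≡ = divide-pos (e ℚ.* ½) A (half-pos e 0<e) 0<A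
    s , 0<s , Bs≡ = divide-pos (e ℚ.* ½) B (half-pos e 0<e) 0<B
    M , y-y′ = y∼y′ r 0<r
    N , x-x′ = x∼x′ s 0<s
    K≤ = ℕ.≤-trans (ℕ.m≤m⊔n K L) (ℕ.m≤m⊔n (K ℕ.⊔ L) (M ℕ.⊔ N))
    L≤ = ℕ.≤-trans (ℕ.m≤n⊔m K L) (ℕ.m≤m⊔n (K ℕ.⊔ L) (M ℕ.⊔ N))
    M≤ = ℕ.≤-trans (ℕ.m≤m⊔n M N) (ℕ.m≤n⊔m (K ℕ.⊔ L) (M ℕ.⊔ N))
    N≤ = ℕ.≤-trans (ℕ.m≤n⊔m M N) (ℕ.m≤n⊔m (K ℕ.⊔ L) (M ℕ.⊔ N))
  in (K ℕ.⊔ L) ℕ.⊔ (M ℕ.⊔ N) , λ m n ≤m ≤n →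
    subst (ℚ.∣ x m ℚ.* y m ℚ.- x′ n ℚ.* y′ n ∣ ℚ.≤_)
      (trans (cong₂ ℚ._+_ Ar≡ Bs≡) (half+half e))
      (product-dist (x m) (y m) (x′ n) (y′ n) (ℚ.<⇒≤ 0<A) (ℚ.<⇒≤ 0<B)
        (x≤A m (ℕ.≤-trans K≤ ≤m)) (y′≤B n (ℕ.≤-trans L≤ ≤n))
        (y-y′ m n (ℕ.≤-trans M≤ ≤m) (ℕ.≤-trans M≤ ≤n))
        (x-x′ m n (ℕ.≤-trans N≤ ≤m) (ℕ.≤-trans N≤ ≤n)))

-- Without η, and with operations defined by copatterns, the sequences stay
-- folded up during unification.
record ℝ : Set where
  no-eta-equality
  field
    seq    : ℕ → ℚ
    cauchy : seq ∼ seq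
open ℝ public

infix 4 _≈ℝ_
record _≈ℝ_ (x y : ℝ) : Set where
  constructor mk≈
  field un≈ : seq x ∼ seq y
open _≈ℝ_ public

infixl 6 _+ℝ_
infixl 7 _*ℝ_

_+ℝ_ _*ℝ_ : ℝ → ℝ → ℝ
seq    (x +ℝ y) n = seq x n ℚ.+ seq y n
cauchy (x +ℝ y)   = ∼-+ {seq x} {seq x} {seq y} {seq y} (cauchy x) (cauchy y)
seq    (x *ℝ y) n = seq x n ℚ.* seq y n
cauchy (x *ℝ y)   = ∼-* {seq x} {seq x} {seq y} {seq y} (cauchy x) (cauchy y)

-ℝ_ : ℝ → ℝ
seq    (-ℝ x) n = ℚ.- seq x n
cauchy (-ℝ x)   = ∼-neg {seq x} {seq x} (cauchy x)

fromℚ : ℚ → ℝ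
seq    (fromℚ q) _ = q
cauchy (fromℚ q)   = ∼-const q

private
  pointwise : ∀ {x y} → (∀ n → seq x n ≡ seq y n) → x ≈ℝ y
  pointwise {x} {y} p = mk≈ (∼-pointwise {seq x} {seq y} (cauchy x) p)

ℝ-isCommutativeRing : IsCommutativeRing _≈ℝ_ _+ℝ_ _*ℝ_ -ℝ_ (fromℚ 0ℚ) (fromℚ 1ℚ)
ℝ-isCommutativeRing = record
  { isRing = record
    { +-isAbelianGroup = record
      { isGroup = record
        { isMonoid = record
          { isSemigroup = record
            { isMagma = record
              { isEquivalence = ≈-isEquivalence
              ; ∙-cong = λ {x} {x′} {y} {y′} p q →
                  mk≈ (∼-+ {seq x} {seq x′} {seq y} {seq y′} (un≈ p) (un≈ q)) }
            ; assoc = λ x y z → pointwise (λ n → ℚ.+-assoc (seq x n) (seq y n) (seq z n)) }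
          ; identity = (λ x → pointwise (λ n → ℚ.+-identityˡ (seq x n)))
                     , (λ x → pointwise (λ n → ℚ.+-identityʳ (seq x n))) }
        ; inverse = (λ x → pointwise (λ n → ℚ.+-inverseˡ (seq x n)))
                  , (λ x → pointwise (λ n → ℚ.+-inverseʳ (seq x n)))
        ; ⁻¹-cong = λ {x} {y} p → mk≈ (∼-neg {seq x} {seq y} (un≈ p)) }
      ; comm = λ x y → pointwise (λ n → ℚ.+-comm (seq x n) (seq y n)) }
    ; *-cong = λ {x} {x′} {y} {y′} p q →
        mk≈ (∼-* {seq x} {seq x′} {seq y} {seq y′} (un≈ p) (un≈ q))
    ; *-assoc = λ x y z → pointwise (λ n → ℚ.*-assoc (seq x n) (seq y n) (seq z n))
    ; *-identity = (λ x → pointwise (λ n → ℚ.*-identityˡ (seq x n)))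
                 , (λ x → pointwise (λ n → ℚ.*-identityʳ (seq x n)))
    ; distrib = (λ x y z → pointwise (λ n → ℚ.*-distribˡ-+ (seq x n) (seq y n) (seq z n)))
              , (λ x y z → pointwise (λ n → ℚ.*-distribʳ-+ (seq x n) (seq y n) (seq z n))) }
  ; *-comm = λ x y → pointwise (λ n → ℚ.*-comm (seq x n) (seq y n)) }
  where
  ≈-isEquivalence : IsEquivalence _≈ℝ_
  ≈-isEquivalence = record
    { refl  = λ {x} → mk≈ (cauchy x)
    ; sym   = λ {x} {y} p → mk≈ (∼-sym {seq x} {seq y} (un≈ p))
    ; trans = λ {x} {y} {z} p q → mk≈ (∼-trans {seq x} {seq y} {seq z} (un≈ p) (un≈ q)) }

ℝ-commutativeRing : CommutativeRing 0ℓ 0ℓ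
ℝ-commutativeRing = record { isCommutativeRing = ℝ-isCommutativeRing }

infix 4 _≤ℝ_
_≤ℝ_ : ℝ → ℝ → Set
x ≤ℝ y = ∀ e → 0ℚ ℚ.< e → ∃[ N ] ∀ n → N ℕ.≤ n → seq x n ℚ.≤ seq y n ℚ.+ e

PositiveReal : ℝ → Set
PositiveReal x = ∃[ d ] 0ℚ ℚ.< d × fromℚ d ≤ℝ x

record ℂ : Set where
  no-eta-equality
  field
    Re Im : ℝ
open ℂ public

infix 4 _≈ℂ_
record _≈ℂ_ (z w : ℂ) : Set where
  constructor _,_
  field
    Re-≈ : Re z ≈ℝ Re w
    Im-≈ : Im z ≈ℝ Im w

infixl 6 _+ℂ_
infixl 7 _*ℂ_

_+ℂ_ _*ℂ_ : ℂ → ℂ → ℂ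
Re (z +ℂ w) = Re z +ℝ Re w
Im (z +ℂ w) = Im z +ℝ Im w
Re (z *ℂ w) = Re z *ℝ Re w +ℝ -ℝ (Im z *ℝ Im w)
Im (z *ℂ w) = Re z *ℝ Im w +ℝ Im z *ℝ Re w

-ℂ_ : ℂ → ℂ
Re (-ℂ z) = -ℝ Re z
Im (-ℂ z) = -ℝ Im z

ofℝ : ℝ → ℂ
Re (ofℝ x) = x
Im (ofℝ x) = fromℚ 0ℚ

ofℚ : ℚ → ℂ
ofℚ q = ofℝ (fromℚ q)

𝑖 : ℂ
Re 𝑖 = fromℚ 0ℚ
Im 𝑖 = fromℚ 1ℚ

private
  module R = CommutativeRing ℝ-commutativeRing

  ≈ℂ-isEquivalence : IsEquivalence _≈ℂ_
  ≈ℂ-isEquivalence = record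
    { refl  = λ {z} → R.refl {Re z} , R.refl {Im z}
    ; sym   = λ { (p , q) → R.sym p , R.sym q }
    ; trans = λ { (p , q) (p′ , q′) → R.trans p p′ , R.trans q q′ } }

  ≈ℂ-trans = IsEquivalence.trans ≈ℂ-isEquivalence

  +ℂ-cong : ∀ {z z′ w w′} → z ≈ℂ z′ → w ≈ℂ w′ → z +ℂ w ≈ℂ z′ +ℂ w′
  +ℂ-cong (p , q) (p′ , q′) = R.+-cong p p′ , R.+-cong q q′

  *ℂ-cong : ∀ {z z′ w w′} → z ≈ℂ z′ → w ≈ℂ w′ → z *ℂ w ≈ℂ z′ *ℂ w′
  *ℂ-cong (p , q) (p′ , q′) =
      R.+-cong (R.*-cong p p′) (R.-‿cong (R.*-cong q q′))
    , R.+-cong (R.*-cong p q′) (R.*-cong q p′)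

  module Identities where
    open +-*-Solver
    open import Data.Rational.Base using (_+_; _*_; -_)

    assoc-re : ∀ a b c d e f →
      (a * c + - (b * d)) * e + - ((a * d + b * c) * f)
      ≡ a * (c * e + - (d * f)) + - (b * (c * f + d * e))
    assoc-re = solve 6 (λ a b c d e f →
      (a :* c :+ :- (b :* d)) :* e :+ :- ((a :* d :+ b :* c) :* f)
      := a :* (c :* e :+ :- (d :* f)) :+ :- (b :* (c :* f :+ d :* e))) refl

    assoc-im : ∀ a b c d e f →
      (a * c + - (b * d)) * f + (a * d + b * c) * e
      ≡ a * (c * f + d * e) + b * (c * e + - (d * f))
    assoc-im = solve 6 (λ a b c d e f →
      (a :* c :+ :- (b :* d)) :* f :+ (a :* d :+ b :* c) :* e
      := a :* (c :* f :+ d :* e) :+ b :* (c :* e :+ :- (d :* f))) refl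

    comm-re : ∀ a b c d → a * c + - (b * d) ≡ c * a + - (d * b)
    comm-re = solve 4 (λ a b c d → a :* c :+ :- (b :* d) := c :* a :+ :- (d :* b)) refl

    comm-im : ∀ a b c d → a * d + b * c ≡ c * b + d * a
    comm-im = solve 4 (λ a b c d → a :* d :+ b :* c := c :* b :+ d :* a) refl

    identity-re : ∀ a b → 1ℚ * a + - (0ℚ * b) ≡ a
    identity-re = solve 2 (λ a b → con 1ℚ :* a :+ :- (con 0ℚ :* b) := a) refl

    identity-im : ∀ a b → 1ℚ * b + 0ℚ * a ≡ b
    identity-im = solve 2 (λ a b → con 1ℚ :* b :+ con 0ℚ :* a := b) refl

    distrib-re : ∀ a b c d e f →
      a * (c + e) + - (b * (d + f)) ≡ (a * c + - (b * d)) + (a * e + - (b * f))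
    distrib-re = solve 6 (λ a b c d e f →
      a :* (c :+ e) :+ :- (b :* (d :+ f))
      := (a :* c :+ :- (b :* d)) :+ (a :* e :+ :- (b :* f))) refl

    distrib-im : ∀ a b c d e f →
      a * (d + f) + b * (c + e) ≡ (a * d + b * c) + (a * f + b * e)
    distrib-im = solve 6 (λ a b c d e f →
      a :* (d :+ f) :+ b :* (c :+ e)
      := (a :* d :+ b :* c) :+ (a :* f :+ b :* e)) refl

  ≈ℂ-pointwise : ∀ z w →
    (∀ n → seq (Re z) n ≡ seq (Re w) n) → (∀ n → seq (Im z) n ≡ seq (Im w) n) → z ≈ℂ w
  ≈ℂ-pointwise z w p q = pointwise {Re z} {Re w} p , pointwise {Im z} {Im w} q

  *ℂ-assoc : ∀ z w v → (z *ℂ w) *ℂ v ≈ℂ z *ℂ (w *ℂ v)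
  *ℂ-assoc z w v = ≈ℂ-pointwise ((z *ℂ w) *ℂ v) (z *ℂ (w *ℂ v))
    (λ n → Identities.assoc-re (seq (Re z) n) (seq (Im z) n) (seq (Re w) n) (seq (Im w) n) (seq (Re v) n) (seq (Im v) n))
    (λ n → Identities.assoc-im (seq (Re z) n) (seq (Im z) n) (seq (Re w) n) (seq (Im w) n) (seq (Re v) n) (seq (Im v) n))

  *ℂ-comm : ∀ z w → z *ℂ w ≈ℂ w *ℂ z
  *ℂ-comm z w = ≈ℂ-pointwise (z *ℂ w) (w *ℂ z)
    (λ n → Identities.comm-re (seq (Re z) n) (seq (Im z) n) (seq (Re w) n) (seq (Im w) n))
    (λ n → Identities.comm-im (seq (Re z) n) (seq (Im z) n) (seq (Re w) n) (seq (Im w) n))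

  *ℂ-identityˡ : ∀ z → ofℚ 1ℚ *ℂ z ≈ℂ z
  *ℂ-identityˡ z = ≈ℂ-pointwise (ofℚ 1ℚ *ℂ z) z
    (λ n → Identities.identity-re (seq (Re z) n) (seq (Im z) n))
    (λ n → Identities.identity-im (seq (Re z) n) (seq (Im z) n))

  *ℂ-distribˡ : ∀ z w v → z *ℂ (w +ℂ v) ≈ℂ z *ℂ w +ℂ z *ℂ v
  *ℂ-distribˡ z w v =
    ≈ℂ-pointwise (z *ℂ (w +ℂ v)) (z *ℂ w +ℂ z *ℂ v)
    (λ n → Identities.distrib-re (seq (Re z) n) (seq (Im z) n) (seq (Re w) n) (seq (Im w) n) (seq (Re v) n) (seq (Im v) n))
    (λ n → Identities.distrib-im (seq (Re z) n) (seq (Im z) n) (seq (Re w) n) (seq (Im w) n) (seq (Re v) n) (seq (Im v) n))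

ℂ-isCommutativeRing : IsCommutativeRing _≈ℂ_ _+ℂ_ _*ℂ_ -ℂ_ (ofℚ 0ℚ) (ofℚ 1ℚ)
ℂ-isCommutativeRing = record
  { isRing = record
    { +-isAbelianGroup = record
      { isGroup = record
        { isMonoid = record
          { isSemigroup = record
            { isMagma = record
              { isEquivalence = ≈ℂ-isEquivalence
              ; ∙-cong = +ℂ-cong }
            ; assoc = λ z w v → R.+-assoc (Re z) (Re w) (Re v) , R.+-assoc (Im z) (Im w) (Im v) }
          ; identity = (λ z → R.+-identityˡ (Re z) , R.+-identityˡ (Im z))
                     , (λ z → R.+-identityʳ (Re z) , R.+-identityʳ (Im z)) }
        ; inverse = (λ z → R.-‿inverseˡ (Re z) , R.-‿inverseˡ (Im z))
                  , (λ z → R.-‿inverseʳ (Re z) , R.-‿inverseʳ (Im z))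
        ; ⁻¹-cong = λ { (p , q) → R.-‿cong p , R.-‿cong q } }
      ; comm = λ z w → R.+-comm (Re z) (Re w) , R.+-comm (Im z) (Im w) }
    ; *-cong = *ℂ-cong
    ; *-assoc = *ℂ-assoc
    ; *-identity = *ℂ-identityˡ
                 , (λ z → ≈ℂ-trans (*ℂ-comm z (ofℚ 1ℚ)) (*ℂ-identityˡ z))
    ; distrib = *ℂ-distribˡ
              , (λ z w v → ≈ℂ-trans (*ℂ-comm (w +ℂ v) z)
                  (≈ℂ-trans (*ℂ-distribˡ z w v) (+ℂ-cong (*ℂ-comm z w) (*ℂ-comm z v)))) }
  ; *-comm = *ℂ-comm }

ℂ-commutativeRing : CommutativeRing 0ℓ 0ℓ
ℂ-commutativeRing = record { isCommutativeRing = ℂ-isCommutativeRing }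

-- z ≼ w means |z| ≤ |w|.
infix 4 _≼_
_≼_ : ℂ → ℂ → Set
z ≼ w = normSq z ≤ℝ normSq w
  where
  normSq : ℂ → ℝ
  normSq v = Re v *ℝ Re v +ℝ Im v *ℝ Im v

module RingTheory (R : CommutativeRing 0ℓ 0ℓ) where
  open CommutativeRing R
  open RawSemiringDefs (Semiring.rawSemiring semiring) public using (_^_; sum) renaming (_×_ to _·_)

  fromℤ : ℤ → Carrier
  fromℤ (+ n)    = n · 1#
  fromℤ -[1+ n ] = - (suc n · 1#)

  -- c₀ + c₁ x + ⋯ + cₙ₋₁ xⁿ⁻¹
  evaluate : ∀ {n} → (Fin n → Carrier) → Carrier → Carrier
  evaluate c x = sum (λ j → c j * x ^ toℕ j)

  IsIntegral : Carrier → Set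
  IsIntegral x = ∃[ n ] Σ[ c ∈ (Fin n → ℤ) ] x ^ n + evaluate (fromℤ ∘ c) x ≈ 0#

  HasCharacteristic : ℕ → Set
  HasCharacteristic p = ∀ n → fromℤ (+ n) ≈ 0# ⇔ p ℕ.∣ n

  record IsField : Set where
    field
      nontrivial : ¬ 1# ≈ 0#
      invertible : ∀ x → ¬ x ≈ 0# → ∃[ y ] x * y ≈ 1#

  -- An algebraic closure of ℚ for p = 0, and of 𝔽ₚ for p prime.  Algebraicity
  -- over the prime field is expressed with integer coefficients, which is no
  -- restriction because denominators can be cleared.
  record IsAlgebraicClosureOfPrimeField (p : ℕ) : Set where
    field
      isField             : IsField
      characteristic      : HasCharacteristic p
      algebraic           : ∀ x → ∃[ n ] Σ[ c ∈ (Fin n → ℤ) ]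
                              (∃[ j ] ¬ fromℤ (c j) ≈ 0#) × evaluate (fromℤ ∘ c) x ≈ 0#
      algebraicallyClosed : ∀ {n} (c : Fin (suc n) → Carrier) →
                              ∃[ x ] x ^ suc n + evaluate c x ≈ 0#

  -- P is a prime ideal of the subring 𝒪, and contains the prime number p.
  record IsPrimeAbove (p : ℕ) (𝒪 P : Carrier → Set) : Set where
    field
      ⊆𝒪       : ∀ {x} → P x → 𝒪 x
      ≈-closed : ∀ {x y} → x ≈ y → P x → P y
      0∈       : P 0#
      +-closed : ∀ {x y} → P x → P y → P (x + y)
      *-closed : ∀ {r x} → 𝒪 r → P x → P (r * x)
      proper   : ¬ P 1#
      prime    : ∀ {x y} → 𝒪 x → 𝒪 y → P (x * y) → P x ⊎ P y
      above    : P (fromℤ (+ p))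

  -- An embedding of the residue field 𝒪 / P into F, given as a ring
  -- homomorphism from 𝒪 to F with kernel P.  The laws range over all proofs of
  -- membership, so that the closure of 𝒪 under the operations is not needed.
  record ResidueEmbedding (𝒪 P : Carrier → Set) (F : CommutativeRing 0ℓ 0ℓ) : Set where
    private module F = CommutativeRing F
    field
      ⟦_⟧     : ∀ {x} → 𝒪 x → F.Carrier
      ⟦⟧-cong : ∀ {x y} (x∈ : 𝒪 x) (y∈ : 𝒪 y) → x ≈ y → ⟦ x∈ ⟧ F.≈ ⟦ y∈ ⟧
      1-homo : (1∈ : 𝒪 1#) → ⟦ 1∈ ⟧ F.≈ F.1#
      +-homo : ∀ {x y} (x∈ : 𝒪 x) (y∈ : 𝒪 y) (x+y∈ : 𝒪 (x + y)) →
               ⟦ x+y∈ ⟧ F.≈ ⟦ x∈ ⟧ F.+ ⟦ y∈ ⟧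
      *-homo : ∀ {x y} (x∈ : 𝒪 x) (y∈ : 𝒪 y) (xy∈ : 𝒪 (x * y)) →
               ⟦ xy∈ ⟧ F.≈ ⟦ x∈ ⟧ F.* ⟦ y∈ ⟧
      kernel : ∀ {x} (x∈ : 𝒪 x) → ⟦ x∈ ⟧ F.≈ F.0# ⇔ P x

module ℂᴿ where
  open CommutativeRing ℂ-commutativeRing public
  open RingTheory ℂ-commutativeRing public

data ℚ⟨_⟩ (S : ℂ → Set) : ℂ → Set where
  generator : ∀ {z} → S z → ℚ⟨ S ⟩ z
  respects  : ∀ {z w} → z ≈ℂ w → ℚ⟨ S ⟩ z → ℚ⟨ S ⟩ w
  one       : ℚ⟨ S ⟩ ℂᴿ.1#
  add       : ∀ {z w} → ℚ⟨ S ⟩ z → ℚ⟨ S ⟩ w → ℚ⟨ S ⟩ (z +ℂ w)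
  negate    : ∀ {z} → ℚ⟨ S ⟩ z → ℚ⟨ S ⟩ (-ℂ z)
  multiply  : ∀ {z w} → ℚ⟨ S ⟩ z → ℚ⟨ S ⟩ w → ℚ⟨ S ⟩ (z *ℂ w)
  invert    : ∀ {z w} → ℚ⟨ S ⟩ z → z *ℂ w ≈ℂ ℂᴿ.1# → ℚ⟨ S ⟩ w

record Mat₂ (A : Set) : Set where
  constructor mat
  field
    m₁₁ m₁₂ m₂₁ m₂₂ : A
open Mat₂ public

detℤ : Mat₂ ℤ → ℤ
detℤ (mat a b c d) = a ℤ.* d ℤ.- b ℤ.* c

-- Subgroups of SL(2,ℤ) are predicates on integer matrices, and a set of residue
-- classes modulo n is given by a set H of representatives in ℕ.
Γ[_,_] : (n : ℕ) (H : ℕ → Set) → Mat₂ ℤ → Set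
Γ[ n , H ] M = detℤ M ≡ + 1 × + n ℤ.∣ m₂₁ M × ∃[ x ] H x × + n ℤ.∣ m₂₂ M ℤ.- + x

Γ₀ : ℕ → Mat₂ ℤ → Set
Γ₀ n = Γ[ n , (λ x → Coprime x n) ]

record ℍ : Set where
  field
    point    : ℂ
    positive : PositiveReal (Im point)
open ℍ public

HasSum : (ℕ → ℂ) → ℂ → Set
HasSum s z = ∀ e → 0ℚ ℚ.< e →
  ∃[ N ] ∀ n → N ℕ.≤ n → ℂᴿ.sum {n} (λ m → s (toℕ m)) ℂᴿ.- z ≼ ofℚ e

IsExp : (z w : ℂ) → Set
IsExp z w = HasSum (λ n → ofℚ ((+ 1 ℚ./ n !) {{n ℕ.!≢0}}) *ℂ z ℂᴿ.^ n) w

-- Leibniz's series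
IsPi : ℝ → Set
IsPi π = HasSum (λ n → ofℚ ((ℤ.- + 1) ℤ.^ n ℤ.* + 4 ℚ./ suc (2 ℕ.* n))) (ofℝ π)

IsHolomorphic : (ℍ → ℂ) → Set
IsHolomorphic f = ∀ τ → ∃[ f′ ] ∀ e → 0ℚ ℚ.< e → ∃[ d ] 0ℚ ℚ.< d × (∀ σ →
  let h = point σ ℂᴿ.- point τ in
  h ≼ ofℚ d → (f σ ℂᴿ.- f τ) ℂᴿ.- f′ *ℂ h ≼ ofℚ e *ℂ h)

VanishesAtInfinity : (ℍ → ℂ) → Set
VanishesAtInfinity f = ∀ e → 0ℚ ℚ.< e →
  ∃[ A ] ∀ τ → fromℚ A ≤ℝ Im (point τ) → f τ ≼ ofℚ e

-- The sum of aₘ qᵐ over m > 0, with q = exp(2πiτ), converges to f(τ).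
IsQExpansion : (f : ℍ → ℂ) (a : ℕ → ℂ) → Set
IsQExpansion f a = ∀ π → IsPi π → ∀ τ q →
  IsExp (ofℚ (+ 2 ℚ./ 1) *ℂ ofℝ π *ℂ 𝑖 *ℂ point τ) q →
  HasSum (λ m → a (suc m) *ℂ q ℂᴿ.^ suc m) (f τ)

-- g = f|ₖM for an integer matrix M of positive determinant, where
-- (f|ₖM)(τ) = det(M)ᵏ⁻¹ (cτ + d)⁻ᵏ f(Mτ).  Denominators are cleared, and Mτ is
-- the point σ with (cτ + d)σ = aτ + b.
IsSlash : (k : ℕ) (f : ℍ → ℂ) (M : Mat₂ ℤ) (g : ℍ → ℂ) → Set
IsSlash k f M@(mat a b c d) g = ∀ τ σ →
  let j = ℂᴿ.fromℤ c *ℂ point τ +ℂ ℂᴿ.fromℤ d in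
  j *ℂ point σ ≈ℂ ℂᴿ.fromℤ a *ℂ point τ +ℂ ℂᴿ.fromℤ b →
  j ℂᴿ.^ k *ℂ g τ ≈ℂ ℂᴿ.fromℤ (detℤ M) ℂᴿ.^ (k ℕ.∸ 1) *ℂ f σ

record IsCuspForm (k : ℕ) (Γ : Mat₂ ℤ → Set) (f : ℍ → ℂ) : Set where
  field
    congruent   : ∀ {τ σ} → point τ ≈ℂ point σ → f τ ≈ℂ f σ
    holomorphic : IsHolomorphic f
    invariant   : ∀ {M} → Γ M → IsSlash k f M f
    cuspidal    : ∀ {M} → detℤ M ≡ + 1 → ∀ {g} → IsSlash k f M g → VanishesAtInfinity g

-- Only the values at integers prime to n matter.
record DirichletCharacter (n : ℕ) : Set where
  field
    ⟨_⟩      : ℤ → ℂ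
    periodic : ∀ {x y} → + n ℤ.∣ x ℤ.- y → ⟨ x ⟩ ≈ℂ ⟨ y ⟩
    1-homo   : ⟨ + 1 ⟩ ≈ℂ ℂᴿ.1#
    *-homo   : ∀ {x y} → Coprime ℤ.∣ x ∣ n → Coprime ℤ.∣ y ∣ n →
               ⟨ x ℤ.* y ⟩ ≈ℂ ⟨ x ⟩ *ℂ ⟨ y ⟩
open DirichletCharacter public using (⟨_⟩)

trivialCharacter : ∀ n → DirichletCharacter n
trivialCharacter n = record
  { ⟨_⟩      = λ _ → ℂᴿ.1#
  ; periodic = λ _ → ℂᴿ.refl
  ; 1-homo   = ℂᴿ.refl
  ; *-homo   = λ _ _ → ℂᴿ.sym (ℂᴿ.*-identityˡ ℂᴿ.1#) }

-- g = ⟨d⟩f for f of weight k on Γ₁(n).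
IsDiamond : (n k : ℕ) (d : ℤ) (f g : ℍ → ℂ) → Set
IsDiamond n k d f g = ∃[ M ]
  detℤ M ≡ + 1 × + n ℤ.∣ m₂₁ M × + n ℤ.∣ m₂₂ M ℤ.- d × IsSlash k f M g

-- g = Tₚf for f of weight k on Γ₁(n), where Tₚf is the sum of f|ₖ(1 j; 0 p) over
-- 0 ≤ j < p, plus (⟨p⟩f)|ₖ(p 0; 0 1) when p does not divide n.
IsHecke : (n k p : ℕ) (f g : ℍ → ℂ) → Set
IsHecke n k p f g = Σ[ s ∈ (Fin p → ℍ → ℂ) ] Σ[ t ∈ (ℍ → ℂ) ]
  (∀ j → IsSlash k f (mat (+ 1) (+ toℕ j) (+ 0) (+ p)) (s j)) ×
  (p ℕ.∣ n → ∀ τ → t τ ≈ℂ ℂᴿ.0#) ×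
  (¬ p ℕ.∣ n → ∃[ u ] IsDiamond n k (+ p) f u × IsSlash k u (mat (+ p) (+ 0) (+ 0) (+ 1)) t) ×
  (∀ τ → g τ ≈ℂ ℂᴿ.sum (λ j → s j τ) +ℂ t τ)

-- A normalized eigenform in Sₖ(Γ), for a group Γ containing Γ₁(n), with
-- nebentypus ε modulo n and with q-expansion coefficients a.
record NormalizedEigenform (n k : ℕ) (Γ : Mat₂ ℤ → Set) (ε : DirichletCharacter n) : Set where
  field
    form       : ℍ → ℂ
    isCuspForm : IsCuspForm k Γ form
    nebentypus : ∀ {M} → Γ₀ n M → IsSlash k form M (λ τ → ⟨ ε ⟩ (m₂₂ M) *ℂ form τ)
    hecke      : ∀ {p} → Prime p → ∃[ c ] IsHecke n k p form (λ τ → c *ℂ form τ)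
    a          : ℕ → ℂ
    qExpansion : IsQExpansion form a
    normalized : a 1 ≈ℂ ℂᴿ.1#

  K : ℂ → Set
  K = ℚ⟨ (λ z → ∃[ m ] z ≈ℂ a (suc m)) ⟩

  𝒪 : ℂ → Set
  𝒪 z = K z × ℂᴿ.IsIntegral z

module Galois (Q̄ F : CommutativeRing 0ℓ 0ℓ) where
  private
    module Q where
      open CommutativeRing Q̄ public
      open RingTheory Q̄ public
  open CommutativeRing F
  open RingTheory F
  open RingMorphisms Q.rawRing Q.rawRing using (IsRingIsomorphism)

  -- Every ring automorphism of Q̄ fixes the prime field ℚ.
  record Gal : Set where
    field
      act            : Q.Carrier → Q.Carrier
      isAutomorphism : IsRingIsomorphism act
  open Gal public

  id : Gal
  id = record { isAutomorphism = Identity.isRingIsomorphism Q.rawRing Q.refl }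

  _∘ᴳ_ : Gal → Gal → Gal
  σ ∘ᴳ τ = record { isAutomorphism =
    Composition.isRingIsomorphism Q.trans (isAutomorphism τ) (isAutomorphism σ) }

  infix 4 _≈ᴹ_
  _≈ᴹ_ : (M N : Mat₂ Carrier) → Set
  mat a b c d ≈ᴹ mat a′ b′ c′ d′ = a ≈ a′ × b ≈ b′ × c ≈ c′ × d ≈ d′

  infixl 7 _*ᴹ_
  _*ᴹ_ : (M N : Mat₂ Carrier) → Mat₂ Carrier
  mat a b c d *ᴹ mat a′ b′ c′ d′ =
    mat (a * a′ + b * c′) (a * b′ + b * d′) (c * a′ + d * c′) (c * b′ + d * d′)

  1ᴹ : Mat₂ Carrier
  1ᴹ = mat 1# 0# 0# 1#

  scale : Carrier → Mat₂ Carrier → Mat₂ Carrier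
  scale s (mat a b c d) = mat (s * a) (s * b) (s * c) (s * d)

  det trace : Mat₂ Carrier → Carrier
  det   (mat a b c d) = a * d - b * c
  trace (mat a b c d) = a + d

  IsInvertible : Mat₂ Carrier → Set
  IsInvertible M = ∃[ u ] det M * u ≈ 1#

  -- The characteristic polynomial of M is x² - t x + n.
  HasCharPoly : (M : Mat₂ Carrier) (t n : Carrier) → Set
  HasCharPoly M t n = trace M ≈ t × det M ≈ n

  -- Continuity is for the Krull topology on the Galois group and the discrete
  -- topology on GL₂(F): the stabiliser of finitely many elements of Q̄ acts
  -- trivially.
  record Representation : Set where
    field
      ρ          : Gal → Mat₂ Carrier
      invertible : ∀ σ → IsInvertible (ρ σ)
      congruent  : ∀ {σ τ} → (∀ x → act σ x Q.≈ act τ x) → ρ σ ≈ᴹ ρ τ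
      id-homo    : ρ id ≈ᴹ 1ᴹ
      ∘-homo     : ∀ σ τ → ρ (σ ∘ᴳ τ) ≈ᴹ ρ σ *ᴹ ρ τ
      continuous : Σ[ xs ∈ List Q.Carrier ]
                     (∀ σ → All (λ x → act σ x Q.≈ x) xs → ρ σ ≈ᴹ 1ᴹ)

  Vec₂ : Set
  Vec₂ = Carrier × Carrier

  _*ⱽ_ : Mat₂ Carrier → Vec₂ → Vec₂
  mat a b c d *ⱽ (x , y) = a * x + b * y , c * x + d * y

  _≈ⱽ_ : Vec₂ → Vec₂ → Set
  (x , y) ≈ⱽ (x′ , y′) = x ≈ x′ × y ≈ y′

  _·ⱽ_ : Carrier → Vec₂ → Vec₂
  c ·ⱽ (x , y) = c * x , c * y

  record IsSubspace (W : Vec₂ → Set) : Set where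
    field
      ≈-closed : ∀ {v w} → v ≈ⱽ w → W v → W w
      0∈       : W (0# , 0#)
      +-closed : ∀ {v w} → W v → W w → W (proj₁ v + proj₁ w , proj₂ v + proj₂ w)
      ·-closed : ∀ c {v} → W v → W (c ·ⱽ v)

  module _ (r : Representation) where
    open Representation r

    IsIrreducible : Set₁
    IsIrreducible = ∀ (W : Vec₂ → Set) → IsSubspace W →
      (∀ σ {v} → W v → W (ρ σ *ⱽ v)) →
      (∃[ v ] W v × ¬ v ≈ⱽ (0# , 0#)) → ∀ v → W v

    -- A direct sum of irreducible representations in dimension two: either
    -- irreducible, or the sum of two invariant lines.
    IsSemisimple : Set₁
    IsSemisimple = IsIrreducible ⊎ ∃[ P ] IsInvertible P ×
      (∀ σ → ∃[ s ] ∃[ t ] ρ σ *ᴹ P ≈ᴹ P *ᴹ mat s 0# 0# t)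

    -- The inertia group at 𝔓 is the group of σ with σx ≡ x mod 𝔓 for all
    -- algebraic integers x.
    IsUnramifiedAt : ℕ → Set₁
    IsUnramifiedAt p = ∀ 𝔓 → Q.IsPrimeAbove p Q.IsIntegral 𝔓 →
      ∀ σ → (∀ {x} → Q.IsIntegral x → 𝔓 (act σ x Q.- x)) → ρ σ ≈ᴹ 1ᴹ

  -- The arithmetic Frobenius.  The congruence forces σ to stabilise 𝔓, as 𝔓 is
  -- prime; the same remark applies to the inertia group above.
  IsFrobenius : (p : ℕ) (𝔓 : Q.Carrier → Set) → Gal → Set
  IsFrobenius p 𝔓 σ = ∀ {x} → Q.IsIntegral x → 𝔓 (act σ x Q.- x Q.^ p)

  -- r is the representation ρ_{g,P}, for a prime P of K_g above ℓ.
  record IsAttached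
    (ℓ : ℕ) {n k Γ ε} (g : NormalizedEigenform n k Γ ε) {P : ℂ → Set}
    (φ : ℂᴿ.ResidueEmbedding (NormalizedEigenform.𝒪 g) P F) (r : Representation) : Set₁ where
    open NormalizedEigenform g
    open RingTheory.ResidueEmbedding φ
    open Representation r
    field
      semisimple : IsSemisimple r
      unramified : ∀ {p} → Prime p → ¬ p ℕ.∣ n ℕ.* ℓ → IsUnramifiedAt r p
      frobenius  : ∀ {p} → Prime p → ¬ p ℕ.∣ n ℕ.* ℓ →
        ∀ 𝔓 → Q.IsPrimeAbove p Q.IsIntegral 𝔓 → ∀ σ → IsFrobenius p 𝔓 σ →
        Σ[ a∈ ∈ 𝒪 (a p) ] Σ[ d∈ ∈ 𝒪 (⟨ ε ⟩ (+ p) *ℂ ℂᴿ.fromℤ (+ p) ℂᴿ.^ (k ℕ.∸ 1)) ]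
          HasCharPoly (ρ σ) ⟦ a∈ ⟧ ⟦ d∈ ⟧

  -- χ σ represents the class modulo ℓ of the cyclotomic character at σ.
  IsCyclotomicCharacter : (ℓ : ℕ) (χ : Gal → ℕ) → Set
  IsCyclotomicCharacter ℓ χ = ∀ σ ζ → ζ Q.^ ℓ Q.≈ Q.1# → act σ ζ Q.≈ ζ Q.^ χ σ

  infix 4 _≅_⊗_^′_
  _≅_⊗_^′_ : Representation → Representation → (Gal → ℕ) → ℕ → Set
  r ≅ r′ ⊗ χ ^′ i = ∃[ P ] IsInvertible P ×
    (∀ σ → P *ᴹ ρ r σ ≈ᴹ scale (fromℤ (+ χ σ) ^ i) (ρ r′ σ) *ᴹ P)
    where open Representation

-- y represents xᵉ modulo ℓ.
IsPowerMod : (ℓ x : ℕ) (e : ℤ) (y : ℕ) → Set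
IsPowerMod ℓ x (+ n)    y = + ℓ ℤ.∣ + y ℤ.- + (x ℕ.^ n)
IsPowerMod ℓ x -[1+ n ] y = + ℓ ℤ.∣ + (y ℕ.* x ℕ.^ suc n) ℤ.- + 1

-- P is a prime above ℓ, so xᵉ modulo P only depends on xᵉ modulo ℓ.
H[_,_,_,_,_] : (n ℓ : ℕ) (ε : DirichletCharacter n) (e : ℤ) (P : ℂ → Set) → ℕ → Set
H[ n , ℓ , ε , e , P ] x =
  0 ℕ.< x × x ℕ.< n ℕ.* ℓ × Coprime x (n ℕ.* ℓ) ×
  ∃[ y ] IsPowerMod ℓ x e y × P (⟨ ε ⟩ (+ x) *ℂ ℂᴿ.fromℤ (+ y) ℂᴿ.- ℂᴿ.1#)

-- Γ_H(Nℓ) = Γ₀(Nℓ) if and only if xᵉ ≡ 1 mod ℓ for all x prime to Nℓ, where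
-- e = k − 2 − 2i: every unit modulo Nℓ is the lower right entry of a matrix in
-- Γ₀(Nℓ), and a prime above ℓ meets ℤ in ℓℤ.  By the Chinese remainder theorem
-- x takes all unit classes modulo ℓ.  If ℓ − 1 divides e, Fermat's little theorem
-- applies.  Conversely, with r the remainder of |e| modulo ℓ − 1, xʳ is 1 modulo ℓ
-- for 0 < x < ℓ; if r > 0 its r-th difference r! would vanish modulo ℓ.
module Submission where

open import Defs
open import Algebra.Bundles using (CommutativeRing)
import Algebra.Definitions.RawSemiring as RawSemiringDefs
import Algebra.Properties.CommutativeSemiring.Binomial as Binomial
import Algebra.Properties.Monoid.Mult as MonoidMult
import Algebra.Properties.Monoid.Sum as MonoidSum
import Algebra.Properties.Ring as RingProperties
open import Data.Fin.Base using (Fin; zero; suc; toℕ; fromℕ; inject₁)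
open import Data.Fin.Properties using (toℕ<n; toℕ-fromℕ; toℕ-inject₁)
open import Data.Integer.Base as ℤ using (ℤ; +_; -[1+_]; _-_; 0ℤ; 1ℤ)
import Data.Integer.Properties as ℤ
open import Data.Integer.Divisibility.Signed as ℤ using (_∣_; divides; ∣ᵤ⇒∣; ∣⇒∣ᵤ)
open import Data.Integer.Tactic.RingSolver using (solve-∀)
open import Data.Nat.Base as ℕ
  using (ℕ; zero; suc; _*_; _∸_; _≤_; _<_; _!; _%_; _/_; NonZero; z≤n; s≤s)
open import Data.Nat.Combinatorics using (_C_; nCn≡1; nCk≡n!/k![n-k]!; k![n∸k]!∣n!)
open import Data.Nat.Coprimality as Coprimality using (Coprime; coprime-Bézout; coprime-divisor)
open import Data.Nat.DivMod using (m≡m%n+[m/n]*n; m%n<n; m/n*n≡m)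
import Data.Nat.Divisibility as ℕ
open import Data.Nat.GCD using (module Bézout)
open import Data.Nat.Primality
  using (Prime; euclidsLemma; ¬prime[1]; prime⇒nonZero; prime⇒irreducible)
import Data.Nat.Properties as ℕ
open import Data.Product.Base using (Σ-syntax; ∃-syntax; _×_; _,_; proj₁; proj₂)
open import Data.Sum.Base using (inj₁; inj₂; [_,_]′)
open import Function.Base using (_∘_)
open import Function.Bundles using (_⇔_; mk⇔; Equivalence)
open import Level using (0ℓ)
open import Relation.Binary.PropositionalEquality
  using (_≡_; refl; sym; trans; cong; cong₂; subst; module ≡-Reasoning)
open import Relation.Nullary using (¬_; yes; no; contradiction)

open RawSemiringDefs ℤ.+-*-rawSemiring using (sum) renaming (_×_ to _·_; _^_ to _^ᴿ_)

-- Congruences between integers.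

infix 4 _≡_mod_
-- A record rather than a synonym, so that unification can recover `a`, `b` and `n`; the subtraction
-- in `+ n ∣ a - b` is a function that computes and would hide them.
record _≡_mod_ (a b : ℤ) (n : ℕ) : Set where
  constructor congruent
  field
    difference : + n ∣ a - b
open _≡_mod_

module _ {n : ℕ} where

  mod-reflexive : ∀ {a b} → a ≡ b → a ≡ b mod n
  mod-reflexive {a} refl = congruent (divides 0ℤ (ℤ.+-inverseʳ a))

  mod-sym : ∀ {a b} → a ≡ b mod n → b ≡ a mod n
  mod-sym {a} {b} (congruent d) =
    congruent (subst (+ n ∣_) (identity a b) (ℤ.∣m⇒∣-m d))
    where
    identity : ∀ a b → ℤ.- (a - b) ≡ b - a
    identity = solve-∀

  mod-trans : ∀ {a b c} → a ≡ b mod n → b ≡ c mod n → a ≡ c mod n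
  mod-trans {a} {b} {c} (congruent d) (congruent d′) =
    congruent (subst (+ n ∣_) (identity a b c) (ℤ.∣m∣n⇒∣m+n d d′))
    where
    identity : ∀ a b c → (a - b) ℤ.+ (b - c) ≡ a - c
    identity = solve-∀

  mod-+ : ∀ {a a′ b b′} → a ≡ a′ mod n → b ≡ b′ mod n → a ℤ.+ b ≡ a′ ℤ.+ b′ mod n
  mod-+ {a} {a′} {b} {b′} (congruent d) (congruent d′) =
    congruent (subst (+ n ∣_) (identity a a′ b b′) (ℤ.∣m∣n⇒∣m+n d d′))
    where
    identity : ∀ a a′ b b′ → (a - a′) ℤ.+ (b - b′) ≡ (a ℤ.+ b) - (a′ ℤ.+ b′)
    identity = solve-∀

  mod-+ˡ : ∀ c {a b} → a ≡ b mod n → c ℤ.+ a ≡ c ℤ.+ b mod n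
  mod-+ˡ c = mod-+ {c} (mod-reflexive refl)

  mod-+ʳ : ∀ c {a b} → a ≡ b mod n → a ℤ.+ c ≡ b ℤ.+ c mod n
  mod-+ʳ c e = mod-+ {b = c} e (mod-reflexive refl)

  mod-* : ∀ {a a′ b b′} → a ≡ a′ mod n → b ≡ b′ mod n → a ℤ.* b ≡ a′ ℤ.* b′ mod n
  mod-* {a} {a′} {b} {b′} (congruent d) (congruent d′) =
    congruent (subst (+ n ∣_) (identity a a′ b b′)
      (ℤ.∣m∣n⇒∣m+n (ℤ.∣n⇒∣m*n b d) (ℤ.∣n⇒∣m*n a′ d′)))
    where
    identity : ∀ a a′ b b′ → b ℤ.* (a - a′) ℤ.+ a′ ℤ.* (b - b′) ≡ a ℤ.* b - a′ ℤ.* b′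
    identity = solve-∀

  mod-^ : ∀ {a b} m → a ≡ b mod n → a ℤ.^ m ≡ b ℤ.^ m mod n
  mod-^ zero    _ = mod-reflexive refl
  mod-^ (suc m) e = mod-* e (mod-^ m e)

  ∣⇒≡0 : ∀ {a} → + n ∣ a → a ≡ 0ℤ mod n
  ∣⇒≡0 {a} d = congruent (subst (+ n ∣_) (sym (ℤ.+-identityʳ a)) d)

  mod-sum-0 : ∀ {m} (t : Fin m → ℤ) → (∀ j → t j ≡ 0ℤ mod n) → sum t ≡ 0ℤ mod n
  mod-sum-0 {zero}  t h = mod-reflexive refl
  mod-sum-0 {suc m} t h = mod-+ (h zero) (mod-sum-0 (t ∘ suc) (h ∘ suc))

mod-weaken : ∀ {a b m n} → m ℕ.∣ n → a ≡ b mod n → a ≡ b mod m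
mod-weaken m∣n (congruent d) = congruent (ℤ.∣-trans (∣ᵤ⇒∣ m∣n) d)

mod-resp-∣ : ∀ {n m x y} → m ℕ.∣ n → + x ≡ + y mod n → m ℕ.∣ x → m ℕ.∣ y
mod-resp-∣ {n} {m} {x} {y} m∣n (congruent d) m∣x =
  ∣⇒∣ᵤ (subst (+ m ∣_) (identity (+ x) (+ y))
    (ℤ.∣m∣n⇒∣m-n {m = + x} (∣ᵤ⇒∣ m∣x) (ℤ.∣-trans (∣ᵤ⇒∣ m∣n) d)))
  where
  identity : ∀ a b → a - (a - b) ≡ b
  identity = solve-∀

pos-^ : ∀ x n → + (x ℕ.^ n) ≡ (+ x) ℤ.^ n
pos-^ x zero    = refl
pos-^ x (suc n) = trans (ℤ.pos-* x (x ℕ.^ n)) (cong (+ x ℤ.*_) (pos-^ x n))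

-- Factorials, binomial coefficients and Fermat's little theorem.

prime∤! : ∀ {p n} → Prime p → n < p → ¬ p ℕ.∣ n !
prime∤! {p} {zero} pr _ p∣1 = ¬prime[1] (subst Prime (ℕ.∣1⇒≡1 p∣1) pr)
prime∤! {p} {suc n} pr n<p p∣n! with euclidsLemma (suc n) (n !) pr p∣n!
... | inj₁ p∣n = ℕ.<⇒≱ n<p (ℕ.∣⇒≤ p∣n)
... | inj₂ p∣  = prime∤! pr (ℕ.<-trans (ℕ.n<1+n n) n<p) p∣

-- The prime divides p! = C(p,k) · k! (p - k)!, but neither of the two factorials, whose arguments
-- are smaller than p.
prime∣C : ∀ {p k} → Prime p → 0 < k → k < p → p ℕ.∣ p C k
prime∣C {p@(suc m)} {k} pr 0<k k<p
  with euclidsLemma (p C k) (k ! * (p ∸ k) !) pr (subst (p ℕ.∣_) (sym factors) (ℕ.m∣m*n (m !)))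
  where
  factors : (p C k) * (k ! * (p ∸ k) !) ≡ p !
  factors = trans
    (cong (_* (k ! * (p ∸ k) !)) (nCk≡n!/k![n-k]! (ℕ.<⇒≤ k<p)))
    (m/n*n≡m {{k ℕ.!* (p ∸ k) !≢0}} (k![n∸k]!∣n! (ℕ.<⇒≤ k<p)))
... | inj₁ p∣C = p∣C
... | inj₂ p∣! with euclidsLemma (k !) ((p ∸ k) !) pr p∣!
...   | inj₁ p∣k!     = contradiction p∣k! (prime∤! pr k<p)
...   | inj₂ p∣[p-k]! =
  contradiction p∣[p-k]! (prime∤! pr (ℕ.∸-monoʳ-< 0<k (ℕ.<⇒≤ k<p)))
prime∣C {zero} _ _ ()

·≡* : ∀ n a → n · a ≡ + n ℤ.* a
·≡* zero    a = refl
·≡* (suc n) a = trans (cong (ℤ._+_ a) (·≡* n a)) (sym (ℤ.suc-* (+ n) a))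

^ᴿ≡^ : ∀ a n → a ^ᴿ n ≡ a ℤ.^ n
^ᴿ≡^ a zero    = refl
^ᴿ≡^ a (suc n) = cong (a ℤ.*_) (^ᴿ≡^ a n)

-- Binomial theorem: all terms other than the two outer ones carry a coefficient divisible by p.
frobenius : ∀ {p} → Prime p → ∀ a → (a ℤ.+ 1ℤ) ℤ.^ p ≡ 1ℤ ℤ.+ a ℤ.^ p mod p
frobenius {zero}      pr a = mod-reflexive (contradiction pr λ ())
frobenius {p@(suc m)} pr a = mod-trans
  (mod-reflexive (begin
    (a ℤ.+ 1ℤ) ℤ.^ p
      ≡⟨ ^ᴿ≡^ (a ℤ.+ 1ℤ) p ⟨
    (a ℤ.+ 1ℤ) ^ᴿ p
      ≡⟨ theorem p a 1ℤ ⟩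
    t zero ℤ.+ sum (t ∘ suc)
      ≡⟨ cong₂ ℤ._+_ first (sum-init-last (t ∘ suc)) ⟩
    1ℤ ℤ.+ (sum (t ∘ suc ∘ inject₁) ℤ.+ t (fromℕ p))
      ≡⟨ cong (λ s → 1ℤ ℤ.+ (sum (t ∘ suc ∘ inject₁) ℤ.+ s)) last ⟩
    1ℤ ℤ.+ (sum (t ∘ suc ∘ inject₁) ℤ.+ a ℤ.^ p) ∎))
  (mod-+ˡ 1ℤ (mod-trans
    (mod-+ʳ (a ℤ.^ p) (mod-sum-0 (t ∘ suc ∘ inject₁) middle))
    (mod-reflexive (ℤ.+-identityˡ (a ℤ.^ p)))))
  where
  open ≡-Reasoning
  open MonoidSum ℤ.+-0-monoid using (sum-init-last)
  open Binomial ℤ.+-*-commutativeSemiring using (theorem; binomialTerm)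

  t : Fin (suc p) → ℤ
  t = binomialTerm a 1ℤ p

  1^ : ∀ n → 1ℤ ^ᴿ n ≡ 1ℤ
  1^ n = trans (^ᴿ≡^ 1ℤ n) (ℤ.^-zeroˡ n)

  term : ∀ k → t k ≡ + (p C toℕ k) ℤ.* a ℤ.^ toℕ k
  term k = trans (·≡* (p C toℕ k) _) (cong (+ (p C toℕ k) ℤ.*_)
    (trans (cong₂ ℤ._*_ (^ᴿ≡^ a (toℕ k)) (1^ (p ∸ toℕ k))) (ℤ.*-identityʳ _)))

  first : t zero ≡ 1ℤ
  -- Both `p C 0` and `a ℤ.^ 0` reduce to 1.
  first = term zero

  last : t (fromℕ p) ≡ a ℤ.^ p
  last = trans (term (fromℕ p))
    (trans (cong (λ k → + (p C k) ℤ.* a ℤ.^ k) (toℕ-fromℕ p))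
           (trans (cong (λ c → + c ℤ.* a ℤ.^ p) (nCn≡1 p)) (ℤ.*-identityˡ _)))

  middle : ∀ j → t (suc (inject₁ j)) ≡ 0ℤ mod p
  -- The lower index is j + 1 with j < m = p - 1, hence strictly between 0 and p.
  middle j = ∣⇒≡0 (subst (+ p ∣_) (sym (term (suc (inject₁ j))))
    (ℤ.∣m⇒∣m*n {m = + (p C suc (toℕ (inject₁ j)))} _ (∣ᵤ⇒∣ (prime∣C pr (s≤s z≤n)
      (s≤s (subst (ℕ._< m) (sym (toℕ-inject₁ j)) (toℕ<n j)))))))

-- Induction on `x`, each step adding 1 by `frobenius`.
fermat : ∀ {p} → Prime p → ∀ x → (+ x) ℤ.^ p ≡ + x mod p
fermat {zero}  pr x       = mod-reflexive (contradiction pr λ ())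
fermat {suc m} pr zero    = mod-reflexive refl
fermat {p}     pr (suc x) = mod-trans
  (mod-reflexive (cong (ℤ._^ p) (ℤ.+-comm 1ℤ (+ x))))
  (mod-trans (frobenius pr (+ x)) (mod-+ˡ 1ℤ (fermat pr x)))

-- Factor x^p - x = x (x^(p-1) - 1) and cancel `x` by Euclid's lemma.
fermat-unit : ∀ {p x} → Prime p → ¬ p ℕ.∣ x → (+ x) ℤ.^ (p ∸ 1) ≡ 1ℤ mod p
fermat-unit {zero}      pr _ = mod-reflexive (contradiction pr λ ())
fermat-unit {p@(suc m)} {x} pr p∤x =
  [ (λ p∣x → contradiction p∣x p∤x) , congruent ∘ ∣ᵤ⇒∣ ]′
    (euclidsLemma x ℤ.∣ (+ x) ℤ.^ m - 1ℤ ∣ pr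
      (subst (p ℕ.∣_) (trans (cong ℤ.∣_∣ (identity (+ x) ((+ x) ℤ.^ m))) (ℤ.abs-* (+ x) _))
        (∣⇒∣ᵤ (difference (fermat pr x)))))
  where
  identity : ∀ a b → a ℤ.* b - a ≡ a ℤ.* (b - 1ℤ)
  identity = solve-∀

-- Finite differences of powers.

Δ : (ℕ → ℤ) → ℕ → ℤ
Δ f x = f (suc x) - f x

-- By Newton's interpolation formula these `f` are the integer-valued polynomials of degree at most
-- r, and `c` is r! times the coefficient of x^r.
ConstantDifference : ℕ → ℤ → (ℕ → ℤ) → Set
ConstantDifference zero    c f = ∀ x → f x ≡ c
ConstantDifference (suc r) c f = ConstantDifference r c (Δ f)

constantDifference-cong : ∀ r {c f g} → (∀ x → f x ≡ g x) →
  ConstantDifference r c f → ConstantDifference r c g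
constantDifference-cong zero    f≗g h x = trans (sym (f≗g x)) (h x)
constantDifference-cong (suc r) f≗g h =
  constantDifference-cong r (λ x → cong₂ _-_ (f≗g (suc x)) (f≗g x)) h

constantDifference-shift : ∀ r {c f} →
  ConstantDifference r c f → ConstantDifference r c (f ∘ suc)
constantDifference-shift zero    h = h ∘ suc
constantDifference-shift (suc r) h = constantDifference-shift r h

constantDifference-+ : ∀ r {c d f g} → ConstantDifference r c f → ConstantDifference r d g →
  ConstantDifference r (c ℤ.+ d) (λ x → f x ℤ.+ g x)
constantDifference-+ zero    h k x = cong₂ ℤ._+_ (h x) (k x)
constantDifference-+ (suc r) {f = f} {g} h k =
  constantDifference-cong r (λ x → identity (f (suc x)) (f x) (g (suc x)) (g x))
    (constantDifference-+ r h k)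
  where
  identity : ∀ a b c d → (a - b) ℤ.+ (c - d) ≡ (a ℤ.+ c) - (b ℤ.+ d)
  identity = solve-∀

-- Leibniz rule: Δ (x f) = x Δ f + f (x + 1).
constantDifference-x* : ∀ r {c f} → ConstantDifference r c f →
  ConstantDifference (suc r) (+ suc r ℤ.* c) (λ x → + x ℤ.* f x)
constantDifference-x* zero {c} {f} h x = trans
  (cong₂ (λ a b → + suc x ℤ.* a - + x ℤ.* b) (h (suc x)) (h x))
  (identity (+ x) c)
  where
  identity : ∀ x c → (1ℤ ℤ.+ x) ℤ.* c - x ℤ.* c ≡ 1ℤ ℤ.* c
  identity = solve-∀
constantDifference-x* (suc r) {c} {f} h =
  subst (λ d → ConstantDifference (suc r) d (Δ (λ x → + x ℤ.* f x))) (coefficient (+ suc r) c)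
    (constantDifference-cong (suc r) (λ x → leibniz (+ x) (f (suc x)) (f x))
      (constantDifference-+ (suc r) {f = λ x → + x ℤ.* Δ f x} {g = f ∘ suc}
        (constantDifference-x* r h) (constantDifference-shift (suc r) {f = f} h)))
  where
  coefficient : ∀ s c → s ℤ.* c ℤ.+ c ≡ (1ℤ ℤ.+ s) ℤ.* c
  coefficient = solve-∀
  leibniz : ∀ x a b → x ℤ.* (a - b) ℤ.+ a ≡ (1ℤ ℤ.+ x) ℤ.* a - x ℤ.* b
  leibniz = solve-∀

-- Each further factor x multiplies the constant by the new degree, which builds up the factorial.
constantDifference-^ : ∀ r → ConstantDifference r (+ (r !)) (λ x → (+ x) ℤ.^ r)
constantDifference-^ zero    x = refl
constantDifference-^ (suc r) =
  subst (λ d → ConstantDifference (suc r) d (λ x → (+ x) ℤ.^ suc r)) (sym (ℤ.pos-* (suc r) (r !)))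
    (constantDifference-x* r (constantDifference-^ r))

-- The r-th difference at 1 is an integral combination of the values at 1, ..., r + 1. Starting at 1
-- avoids the argument 0, which is not a unit.
constantDifference-∣ : ∀ {n} r {c f} → ConstantDifference r c f →
  (∀ x → x ≤ r → + n ∣ f (suc x)) → + n ∣ c
constantDifference-∣ {n} zero h k = subst (+ n ∣_) (h 1) (k 0 z≤n)
constantDifference-∣ (suc r) h k = constantDifference-∣ r h λ x x≤r →
  ℤ.∣m∣n⇒∣m-n (k (suc x) (s≤s x≤r)) (k x (ℕ.m≤n⇒m≤1+n x≤r))

-- A function that is constant modulo n on 1, …, r + 1 has r-th difference 0
-- modulo n there, while the r-th difference of xʳ is r!.
^≡1⇒∣! : ∀ {n} r → 0 < r → (∀ x → 0 < x → x ≤ suc r → (+ x) ℤ.^ r ≡ 1ℤ mod n) → n ℕ.∣ r !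
^≡1⇒∣! {n} (suc r) _ h = ∣⇒∣ᵤ (constantDifference-∣ r (constantDifference-^ (suc r)) λ x x≤r →
  difference (mod-trans (h (suc (suc x)) (s≤s z≤n) (s≤s (s≤s x≤r)))
                        (mod-sym (h (suc x) (s≤s z≤n) (s≤s (ℕ.m≤n⇒m≤1+n x≤r))))))

-- Exponents that send every unit modulo a prime to 1.

^*≡1 : ∀ {n a} m q → a ℤ.^ m ≡ 1ℤ mod n → a ℤ.^ (q * m) ≡ 1ℤ mod n
^*≡1 {a = a} m q h = mod-trans
  (mod-reflexive (trans (cong (a ℤ.^_) (ℕ.*-comm q m)) (sym (ℤ.^-*-assoc a m q))))
  (mod-trans (mod-^ q h) (mod-reflexive (ℤ.^-zeroˡ q)))

-- Takes the place of a primitive root: a nonzero remainder of `n` modulo p - 1 would be the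
-- exponent in `^≡1⇒∣!`, making p divide the factorial of a number below p.
p-1∣exponent : ∀ {p} → Prime p → ∀ n →
  (∀ x → 0 < x → x < p → (+ x) ℤ.^ n ≡ 1ℤ mod p) → (p ∸ 1) ℕ.∣ n
p-1∣exponent {0} pr n _ = contradiction pr λ ()
p-1∣exponent {1} pr n _ = contradiction pr ¬prime[1]
p-1∣exponent {p@(suc m@(suc _))} pr n h with n % m ℕ.≟ 0
... | yes r≡0 = ℕ.m%n≡0⇒n∣m n m r≡0
... | no  r≢0 = contradiction (^≡1⇒∣! (n % m) (ℕ.n≢0⇒n>0 r≢0) roots)
                              (prime∤! pr (ℕ.m<n⇒m<1+n (m%n<n n m)))
  where
  roots : ∀ x → 0 < x → x ≤ suc (n % m) → (+ x) ℤ.^ (n % m) ≡ 1ℤ mod p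
  -- With r = `n % m`, the factor x^(m · (n / m)) is 1 by Fermat, so x^r may be multiplied by it to
  -- give x^n.
  roots x 0<x x≤ = mod-trans
    (mod-reflexive (sym (ℤ.*-identityʳ _)))
    (mod-trans (mod-* {a = (+ x) ℤ.^ (n % m)} (mod-reflexive refl) (mod-sym period))
    (mod-trans (mod-reflexive (trans (sym (ℤ.^-distribˡ-+-* (+ x) (n % m) _))
                                     (cong ((+ x) ℤ.^_) (sym (m≡m%n+[m/n]*n n m)))))
               (h x 0<x x<p)))
    where
    x<p : x < p
    -- Here x ≤ r + 1 and r < p - 1, so the arguments needed for the differences all stay below p.
    x<p = s≤s (ℕ.≤-trans x≤ (m%n<n n m))
    period : (+ x) ℤ.^ (n / m * m) ≡ 1ℤ mod p
    period = ^*≡1 m (n / m)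
      (fermat-unit pr (λ p∣x → ℕ.<⇒≱ x<p (ℕ.∣⇒≤ {{ℕ.>-nonZero 0<x}} p∣x)))

-- Units modulo n and matrices with a given lower right entry.

-- When 1 + x m = y n, the inverse of m modulo n is x² m = −x.
coprime-inverse : ∀ {m n} → Coprime m n → ∃[ s ] + s ℤ.* + m ≡ 1ℤ mod n
coprime-inverse {m} {n} c with coprime-Bézout c
... | Bézout.+- x y eq = x , congruent (divides (+ y) (begin
    + x ℤ.* + m - 1ℤ               ≡⟨ cong (_- 1ℤ) (ℤ.pos-* x m) ⟨
    + (x * m) - 1ℤ                 ≡⟨ cong (λ a → + a - 1ℤ) eq ⟨
    1ℤ ℤ.+ + (y * n) - 1ℤ          ≡⟨ identity (+ (y * n)) ⟩
    + (y * n)                      ≡⟨ ℤ.pos-* y n ⟩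
    + y ℤ.* + n                    ∎))
  where
  open ≡-Reasoning
  identity : ∀ a → 1ℤ ℤ.+ a - 1ℤ ≡ a
  identity = solve-∀
... | Bézout.-+ x y eq = x * (x * m) , congruent (divides ((+ (x * m) - 1ℤ) ℤ.* + y) (begin
    + (x * (x * m)) ℤ.* + m - 1ℤ              ≡⟨ cong (λ a → a ℤ.* + m - 1ℤ) (ℤ.pos-* x (x * m)) ⟩
    + x ℤ.* + (x * m) ℤ.* + m - 1ℤ            ≡⟨ rearrange (+ x) (+ (x * m)) (+ m) ⟩
    + (x * m) ℤ.* (+ x ℤ.* + m) - 1ℤ          ≡⟨ cong (λ a → + (x * m) ℤ.* a - 1ℤ) (ℤ.pos-* x m) ⟨
    + (x * m) ℤ.* + (x * m) - 1ℤ              ≡⟨ identity (+ (x * m)) ⟩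
    (+ (x * m) - 1ℤ) ℤ.* + (1 ℕ.+ x * m)      ≡⟨ cong (λ a → (+ (x * m) - 1ℤ) ℤ.* + a) eq ⟩
    (+ (x * m) - 1ℤ) ℤ.* + (y * n)            ≡⟨ cong ((+ (x * m) - 1ℤ) ℤ.*_) (ℤ.pos-* y n) ⟩
    (+ (x * m) - 1ℤ) ℤ.* (+ y ℤ.* + n)        ≡⟨ ℤ.*-assoc (+ (x * m) - 1ℤ) (+ y) (+ n) ⟨
    (+ (x * m) - 1ℤ) ℤ.* + y ℤ.* + n          ∎))
  where
  open ≡-Reasoning
  rearrange : ∀ x a m → x ℤ.* a ℤ.* m - 1ℤ ≡ a ℤ.* (x ℤ.* m) - 1ℤ
  rearrange = solve-∀
  identity : ∀ a → a ℤ.* a - 1ℤ ≡ (a - 1ℤ) ℤ.* (1ℤ ℤ.+ a)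
  identity = solve-∀

coprime-mod : ∀ {n x y} → + x ≡ + y mod n → Coprime x n → Coprime y n
coprime-mod e c (d∣y , d∣n) = c (mod-resp-∣ d∣n (mod-sym e) d∣y , d∣n)

-- A common divisor of `x` and `m * n` is prime to `m`, hence divides `n`, and is then 1.
coprime-* : ∀ {x m n} → Coprime x m → Coprime x n → Coprime x (m * n)
coprime-* {x} {m} {n} c c′ {d} (d∣x , d∣mn) =
  c′ (d∣x , coprime-divisor {d} {m} {n} (λ { (e∣d , e∣m) → c (ℕ.∣-trans e∣d d∣x , e∣m) }) d∣mn)

-- Chinese remainder theorem: `y` is chosen to be 1 modulo `m` and `x` modulo `n`, and is therefore
-- prime to both.
lift-unit : ∀ {m n x} → Coprime m n → Coprime x n →
  ∃[ y ] Coprime y (m * n) × + y ≡ + x mod n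
lift-unit {m} {n} {x} c x⊥n =
    y
  , coprime-* (coprime-mod (mod-sym y≡1) (Coprimality.1-coprimeTo m))
              (coprime-mod (mod-sym y≡x) x⊥n)
  , y≡x
  where
  s t y : ℕ
  s = proj₁ (coprime-inverse (Coprimality.sym c))
  t = proj₁ (coprime-inverse c)
  -- `s * n` is 1 modulo `m` and 0 modulo `n`; `t * m` is 0 modulo `m` and 1 modulo `n`.
  y = s * n ℕ.+ x * (t * m)

  y≡ : + y ≡ + s ℤ.* + n ℤ.+ + x ℤ.* (+ t ℤ.* + m)
  y≡ = cong₂ ℤ._+_ (ℤ.pos-* s n)
    (trans (ℤ.pos-* x (t * m)) (cong (+ x ℤ.*_) (ℤ.pos-* t m)))

  y≡1 : + y ≡ + 1 mod m
  y≡1 = mod-trans (mod-reflexive y≡)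
    (mod-+ {b = + x ℤ.* (+ t ℤ.* + m)} (proj₂ (coprime-inverse (Coprimality.sym c)))
      (∣⇒≡0 (ℤ.∣n⇒∣m*n (+ x) (ℤ.∣n⇒∣m*n (+ t) ℤ.∣-refl))))

  y≡x : + y ≡ + x mod n
  y≡x = mod-trans (mod-reflexive y≡) (mod-trans
    (mod-+ (∣⇒≡0 (ℤ.∣n⇒∣m*n (+ s) ℤ.∣-refl))
           (mod-* {a = + x} (mod-reflexive refl) (proj₂ (coprime-inverse c))))
    (mod-reflexive (trans (ℤ.+-identityˡ _) (ℤ.*-identityʳ (+ x)))))

-- An inverse s of x gives s x - 1 = q n, so the rows (s, q) and (n, x) have determinant 1.
Γ₀-bottom-right : ∀ {n x} → Coprime x n → ∃[ M ] Γ₀ n M × m₂₂ M ≡ + x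
Γ₀-bottom-right {n} {x} c with coprime-inverse c
... | s , congruent (divides q eq) = mat (+ s) q (+ n) (+ x) ,
  ( trans (cong (λ a → + s ℤ.* + x - a) (sym eq)) (identity (+ s ℤ.* + x))
  , ℤ.∣-refl
  , x , c , difference (mod-reflexive {n} {+ x} refl)) , refl
  where
  identity : ∀ a → a - (a - 1ℤ) ≡ + 1
  identity = solve-∀

-- Powers with exponents of either sign.

isPowerMod-1⇒ : ∀ {ℓ x} e {y} → IsPowerMod ℓ x e y → + y ≡ 1ℤ mod ℓ →
  (+ x) ℤ.^ ℤ.∣ e ∣ ≡ 1ℤ mod ℓ
isPowerMod-1⇒ {ℓ} {x} (+ n) {y} h y≡1 =
  subst (_≡ 1ℤ mod ℓ) (pos-^ x n) (mod-trans (mod-sym (congruent {+ y} h)) y≡1)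
isPowerMod-1⇒ {ℓ} {x} -[1+ n ] {y} h y≡1 =
  mod-trans (mod-reflexive (sym (ℤ.*-identityˡ _)))
    (mod-trans (mod-* {b = (+ x) ℤ.^ suc n} (mod-sym y≡1) (mod-reflexive refl))
    (mod-trans (mod-reflexive (sym (trans (ℤ.pos-* y (x ℕ.^ suc n))
                                          (cong (+ y ℤ.*_) (pos-^ x (suc n))))))
    (congruent h)))

isPowerMod-1⇐ : ∀ {ℓ x} e → (+ x) ℤ.^ ℤ.∣ e ∣ ≡ 1ℤ mod ℓ → IsPowerMod ℓ x e 1
isPowerMod-1⇐ {ℓ} {x} (+ n)    h =
  difference (mod-sym (subst (_≡ 1ℤ mod ℓ) (sym (pos-^ x n)) h))
isPowerMod-1⇐ {ℓ} {x} -[1+ n ] h =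
  difference (subst (_≡ 1ℤ mod ℓ)
    (sym (trans (cong +_ (ℕ.*-identityˡ (x ℕ.^ suc n))) (pos-^ x (suc n)))) h)

-- Integers in a prime ideal above ℓ.

module _ (R : CommutativeRing 0ℓ 0ℓ) where
  private
    module R = CommutativeRing R
    module Ideal = RingTheory R
  open RingProperties R.ring using (-1*x≈-x)
  open MonoidMult R.+-monoid using (×-assocˡ)
  open import Relation.Binary.Reasoning.Setoid R.setoid

  -- -1 is the root of the monic polynomial x + 1. It is wanted in `𝒪` because `IsPrimeAbove` gives
  -- closure under negation only through multiplication by -1.
  isIntegral-[-1] : Ideal.IsIntegral (R.- R.1#)
  isIntegral-[-1] = 1 , (λ _ → + 1) , (begin
    R.- R.1# R.* R.1# R.+ ((R.1# R.+ R.0#) R.* R.1# R.+ R.0#)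
      ≈⟨ R.+-cong (R.*-identityʳ _)
          (R.trans (R.+-identityʳ _) (R.trans (R.*-identityʳ _) (R.+-identityʳ _))) ⟩
    R.- R.1# R.+ R.1#
      ≈⟨ R.-‿inverseˡ R.1# ⟩
    R.0# ∎)

  module _ {ℓ 𝒪 P} (pr : Prime ℓ) (-1∈𝒪 : 𝒪 (R.- R.1#)) (P-prime : Ideal.IsPrimeAbove ℓ 𝒪 P) where
    open Ideal.IsPrimeAbove P-prime

    private
      neg-closed : ∀ {x} → P x → P (R.- x)
      neg-closed x∈P = ≈-closed (-1*x≈-x _) (*-closed -1∈𝒪 x∈P)

      ·-closed : ∀ n {x} → P x → P (n Ideal.· x)
      ·-closed zero    x∈P = 0∈
      ·-closed (suc n) x∈P = +-closed x∈P (·-closed n x∈P)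

      -- Writes 1 as b n - a m, a combination of two elements of the ideal.
      bézout-1∈P : ∀ {a b m n} → 1 ℕ.+ a * m ≡ b * n →
        P (m Ideal.· R.1#) → P (n Ideal.· R.1#) → P R.1#
      bézout-1∈P {a} {b} {m} {n} eq m∈P n∈P =
        ≈-closed (begin
          (b * n) Ideal.· R.1# R.+ R.- am
            ≡⟨ cong (λ c → c Ideal.· R.1# R.+ R.- am) eq ⟨
          R.1# R.+ am R.+ R.- am
            ≈⟨ R.+-assoc R.1# am (R.- am) ⟩
          R.1# R.+ (am R.+ R.- am)
            ≈⟨ R.+-congˡ (R.-‿inverseʳ am) ⟩
          R.1# R.+ R.0#
            ≈⟨ R.+-identityʳ R.1# ⟩
          R.1# ∎)
        (+-closed (multiple b n∈P) (neg-closed (multiple a m∈P)))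
        where
        am = (a * m) Ideal.· R.1#
        multiple : ∀ c {k} → P (k Ideal.· R.1#) → P ((c * k) Ideal.· R.1#)
        multiple c {k} k∈P = ≈-closed (×-assocˡ R.1# c k) (·-closed c k∈P)

    -- If ℓ did not divide `n`, the two would be coprime, and a Bézout relation would put 1 into the
    -- proper ideal `P`.
    prime-contraction : ∀ {n} → P (n Ideal.· R.1#) → ℓ ℕ.∣ n
    prime-contraction {n} n∈P with ℓ ℕ.∣? n
    ... | yes ℓ∣n = ℓ∣n
    ... | no  ℓ∤n = contradiction (1∈P (coprime-Bézout ℓ⊥n)) proper
      where
      ℓ⊥n : Coprime ℓ n
      ℓ⊥n (d∣ℓ , d∣n) with prime⇒irreducible pr d∣ℓ
      ... | inj₁ d≡1 = d≡1
      ... | inj₂ refl = contradiction d∣n ℓ∤n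
      1∈P : Bézout.Identity 1 ℓ n → P R.1#
      1∈P (Bézout.+- x y eq) = bézout-1∈P {y} {x} eq n∈P above
      1∈P (Bézout.-+ x y eq) = bézout-1∈P {x} {y} eq above n∈P

    -- The factor `R.1#` is the value of the trivial character. For positive `y` the element is the
    -- natural multiple (y - 1) · 1, to which `prime-contraction` applies; for y = 0 it is -1, which
    -- no proper ideal contains.
    1*y-1∈P⇒y≡1 : ∀ y → P (R.1# R.* Ideal.fromℤ (+ y) R.- R.1#) → + y ≡ 1ℤ mod ℓ
    1*y-1∈P⇒y≡1 zero    h = contradiction (≈-closed (begin
      R.- (R.1# R.* R.0# R.- R.1#)  ≈⟨ R.-‿cong (R.+-congʳ (R.zeroʳ R.1#)) ⟩
      R.- (R.0# R.- R.1#)           ≈⟨ R.-‿cong (R.+-identityˡ _) ⟩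
      R.- R.- R.1#                  ≈⟨ RingProperties.-‿involutive R.ring R.1# ⟩
      R.1#                          ∎) (neg-closed h)) proper
    1*y-1∈P⇒y≡1 (suc m) h =
      congruent (subst (+ ℓ ∣_) (identity (+ m)) (∣ᵤ⇒∣ (prime-contraction (≈-closed (begin
        R.1# R.* (R.1# R.+ m Ideal.· R.1#) R.- R.1#     ≈⟨ R.+-congʳ (R.*-identityˡ _) ⟩
        R.1# R.+ m Ideal.· R.1# R.- R.1#                ≈⟨ R.+-congʳ (R.+-comm R.1# _) ⟩
        m Ideal.· R.1# R.+ R.1# R.- R.1#                ≈⟨ R.+-assoc _ R.1# (R.- R.1#) ⟩
        m Ideal.· R.1# R.+ (R.1# R.- R.1#)              ≈⟨ R.+-congˡ (R.-‿inverseʳ R.1#) ⟩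
        m Ideal.· R.1# R.+ R.0#                         ≈⟨ R.+-identityʳ _ ⟩
        m Ideal.· R.1#                                  ∎) h))))
      where
      identity : ∀ a → a ≡ (1ℤ ℤ.+ a) - 1ℤ
      identity = solve-∀

    1*1-1∈P : P (R.1# R.* Ideal.fromℤ (+ 1) R.- R.1#)
    1*1-1∈P = ≈-closed (begin
      R.0#                                      ≈⟨ R.-‿inverseʳ R.1# ⟨
      R.1# R.- R.1#                             ≈⟨ R.+-congʳ (R.+-identityʳ R.1#) ⟨
      R.1# R.+ R.0# R.- R.1#                    ≈⟨ R.+-congʳ (R.*-identityˡ _) ⟨
      R.1# R.* (R.1# R.+ R.0#) R.- R.1#         ∎) 0∈

-- Comparison of Γ_H(Nℓ) with Γ₀(Nℓ).

-1∈𝒪 : ∀ {n k Γ ε} (g : NormalizedEigenform n k Γ ε) → NormalizedEigenform.𝒪 g (ℂᴿ.- ℂᴿ.1#)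
-1∈𝒪 g = negate one , isIntegral-[-1] ℂ-commutativeRing

module _ {N ℓ : ℕ} {P 𝒪 : ℂ → Set}
         (N>0 : 0 < N) (N⊥ℓ : Coprime N ℓ) (pr : Prime ℓ)
         (-1∈ : 𝒪 (ℂᴿ.- ℂᴿ.1#)) (P-prime : ℂᴿ.IsPrimeAbove ℓ 𝒪 P) (e : ℤ) where
  private
    H : ℕ → Set
    H = H[ N , ℓ , trivialCharacter N , e , P ]

  -- Together with `^≡1⇒H`, this trades the condition modulo `P` in the definition of H for a
  -- congruence modulo ℓ.
  H⇒^≡1 : ∀ {x} → H x → (+ x) ℤ.^ ℤ.∣ e ∣ ≡ 1ℤ mod ℓ
  H⇒^≡1 (_ , _ , _ , y , power , y-1∈P) =
    isPowerMod-1⇒ e power (1*y-1∈P⇒y≡1 ℂ-commutativeRing pr -1∈ P-prime y y-1∈P)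

  ^≡1⇒H : ∀ {x} → 0 < x → x < N * ℓ → Coprime x (N * ℓ) → (+ x) ℤ.^ ℤ.∣ e ∣ ≡ 1ℤ mod ℓ → H x
  ^≡1⇒H 0<x x< c h =
    -- The representative of x^e is taken to be 1.
    0<x , x< , c , 1 , isPowerMod-1⇐ e h , 1*1-1∈P ℂ-commutativeRing pr -1∈ P-prime

  Γ_H⊆Γ₀ : ∀ M → Γ[ N * ℓ , H ] M → Γ₀ (N * ℓ) M
  Γ_H⊆Γ₀ M (det , c , x , (_ , _ , x⊥ , _) , d) = det , c , x , x⊥ , d

  Γ₀⊆Γ_H⇒ℓ-1∣e : (∀ M → Γ₀ (N * ℓ) M → Γ[ N * ℓ , H ] M) → (ℓ ∸ 1) ℕ.∣ ℤ.∣ e ∣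
  Γ₀⊆Γ_H⇒ℓ-1∣e Γ₀⊆Γ_H = p-1∣exponent pr ℤ.∣ e ∣ power
    where
    power : ∀ x → 0 < x → x < ℓ → (+ x) ℤ.^ ℤ.∣ e ∣ ≡ 1ℤ mod ℓ
    power x 0<x x<ℓ =
      let x⊥ℓ = Coprimality.sym (Coprimality.prime⇒coprime pr {{ℕ.>-nonZero 0<x}} x<ℓ)
          -- A unit modulo ℓ is lifted to a unit modulo Nℓ, then to a matrix of Γ₀(Nℓ). Membership
          -- in Γ_H yields some `z` in H, congruent to `y` modulo Nℓ and so to `x` modulo ℓ.
          y , y⊥ , y≡x = lift-unit {N} {ℓ} {x} N⊥ℓ x⊥ℓ
          M , M∈Γ₀ , d≡y = Γ₀-bottom-right {N * ℓ} {y} y⊥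
          _ , _ , z , z∈H , d≡z = Γ₀⊆Γ_H M M∈Γ₀
          y≡z = mod-trans (mod-reflexive (sym d≡y)) (congruent {m₂₂ M} {+ z} d≡z)
          x≡z = mod-trans (mod-sym y≡x) (mod-weaken (ℕ.n∣m*n N) y≡z)
      in mod-trans (mod-^ ℤ.∣ e ∣ x≡z) (H⇒^≡1 {z} z∈H)

  ℓ-1∣e⇒Γ₀⊆Γ_H : (ℓ ∸ 1) ℕ.∣ ℤ.∣ e ∣ → ∀ M → Γ₀ (N * ℓ) M → Γ[ N * ℓ , H ] M
  ℓ-1∣e⇒Γ₀⊆Γ_H (ℕ.divides q ∣e∣≡) M (det , c , x , x⊥ , d) =
    det , c , r , ^≡1⇒H 0<r (m%n<n x n) r⊥ power , difference (mod-trans (congruent {m₂₂ M} d) x≡r)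
    where
    n r : ℕ
    instance
      Nℓ≢0 : NonZero (N * ℓ)
      Nℓ≢0 = ℕ.m*n≢0 N ℓ {{ℕ.>-nonZero N>0}} {{prime⇒nonZero pr}}
    n = N * ℓ
    -- H contains only representatives strictly between 0 and Nℓ, so the given `x` is first reduced.
    r = x % n

    x≡r : + x ≡ + r mod n
    x≡r = congruent (divides (+ (x / n)) (begin
      + x - + r                          ≡⟨ cong (λ a → + a - + r) (m≡m%n+[m/n]*n x n) ⟩
      + r ℤ.+ + (x / n * n) - + r        ≡⟨ identity (+ r) (+ (x / n * n)) ⟩
      + (x / n * n)                      ≡⟨ ℤ.pos-* (x / n) n ⟩
      + (x / n) ℤ.* + n                  ∎))
      where
      open ≡-Reasoning
      identity : ∀ a b → a ℤ.+ b - a ≡ b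
      identity = solve-∀

    r⊥ : Coprime r n
    r⊥ = coprime-mod x≡r x⊥

    ℓ∤r : ¬ ℓ ℕ.∣ r
    ℓ∤r ℓ∣r = ¬prime[1] (subst Prime (r⊥ (ℓ∣r , ℕ.n∣m*n N)) pr)

    0<r : 0 < r
    -- ℓ divides 0 but not `r`, which is prime to Nℓ.
    0<r = ℕ.n≢0⇒n>0 λ r≡0 → ℓ∤r (subst (ℓ ℕ.∣_) (sym r≡0) (ℓ ℕ.∣0))

    power : (+ r) ℤ.^ ℤ.∣ e ∣ ≡ 1ℤ mod ℓ
    power = subst (λ m → (+ r) ℤ.^ m ≡ 1ℤ mod ℓ) (sym ∣e∣≡) (^*≡1 (ℓ ∸ 1) q (fermat-unit pr ℓ∤r))

corollary5p3 :
  (ℓ N k i : ℕ) → Prime ℓ → 5 ≤ ℓ → 0 < N → Coprime N ℓ → 2 < k → i ≤ ℓ ∸ 1 →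
  (Q̄ F̄ : CommutativeRing 0ℓ 0ℓ) →
  RingTheory.IsAlgebraicClosureOfPrimeField Q̄ 0 →
  RingTheory.IsAlgebraicClosureOfPrimeField F̄ ℓ →
  let open Galois Q̄ F̄
      open NormalizedEigenform using (𝒪) in
  (χ : Gal → ℕ) → IsCyclotomicCharacter ℓ χ →
  (f : NormalizedEigenform N k (Γ₀ N) (trivialCharacter N)) →
  (P : ℂ → Set) → ℂᴿ.IsPrimeAbove ℓ (𝒪 f) P →
  (φ : ℂᴿ.ResidueEmbedding (𝒪 f) P F̄) →
  (r : Representation) → IsAttached ℓ f φ r → IsIrreducible r →
  let e = + k - + 2 - + (2 * i)
      Γ-H = Γ[ N * ℓ , H[ N , ℓ , trivialCharacter N , e , P ] ] in
  (Σ[ ε₂ ∈ DirichletCharacter (N * ℓ) ]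
   Σ[ f₂ ∈ NormalizedEigenform (N * ℓ) 2 Γ-H ε₂ ]
   Σ[ P₂ ∈ (ℂ → Set) ] ℂᴿ.IsPrimeAbove ℓ (𝒪 f₂) P₂ ×
   (Σ[ φ₂ ∈ ℂᴿ.ResidueEmbedding (𝒪 f₂) P₂ F̄ ]
    Σ[ r₂ ∈ Representation ] IsAttached ℓ f₂ φ₂ r₂ × r ≅ r₂ ⊗ χ ^′ i)) →
  (∀ M → Γ-H M ⇔ Γ₀ (N * ℓ) M) ⇔ (+ (ℓ ∸ 1) ∣ e)
corollary5p3 ℓ N k i pr _ N>0 N⊥ℓ _ _ Q̄ F̄ _ _ χ _ f P P-prime φ r _ _ _ = mk⇔
  (λ same → ∣ᵤ⇒∣ (Γ₀⊆Γ_H⇒ℓ-1∣e N>0 N⊥ℓ pr (-1∈𝒪 f) P-prime e (λ M → Equivalence.from (same M))))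
  -- Γ_H lies in Γ₀ for every exponent, so the divisibility is spent on the reverse inclusion alone.
  (λ ℓ-1∣e M → mk⇔
    (Γ_H⊆Γ₀ N>0 N⊥ℓ pr (-1∈𝒪 f) P-prime e M)
    (ℓ-1∣e⇒Γ₀⊆Γ_H N>0 N⊥ℓ pr (-1∈𝒪 f) P-prime e (∣⇒∣ᵤ ℓ-1∣e) M))
  where
  e = + k - + 2 - + (2 * i)
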